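{- For every $n\ge 1$, Clarke et al.'s bijection $\Psi$ on $S_n$ factors as $$\Psi=\mathrm{ZDer}^{ -1}\circ \mathbf F\circ \mathbf\Phi^{ -1}\circ \mathrm{ZDer},$$ where $\mathrm{ZDer}$, $\mathbf\Phi$, $\mathbf F$ are as defined in the context.
   Context: Permutations $\sigma\in S_n$ are words $x_1\cdots x_n$; $\mathrm{des}$ of a word $y_1\cdots y_p$ of integers is $\#\{i: y_i>y_{i+1}\}$. $\mathcal D_n$ is the set of derangements of $[n]$. Insertion. For $\sigma=x_1\cdots x_n\in S_n$ with $x_0=x_{n+1}=+\infty$ and $0\le i\le n$, the pair $(i,i+1)$ is the $j$-th slot of $\sigma$ if $x_i\neq i$ and $\sigma$ has exactly $i-j$ fixed points $f<i$. If $(i,i+1)$ is the $j$-th slot, $\langle\sigma,j\rangle=x_1'\cdots x_i'\,(i+1)\,x_{i+1}'\cdots x_n'\in S_{n+1}$, with $x'=x$ if $x\le i$ and $x'=x+1$ if $x>i$. Set $\langle\sigma,i_1,\dots,i_m\rangle=\langle\langle\sigma,i_1,\dots,i_{m-1}\rangle,i_m\rangle$. For $\sigma\in\mathcal D_n$ let $S(\sigma,m)=\{\langle\sigma,i_1,\dots,i_m\rangle: 0\le i_1\le\dots\le i_m\le n\}\subseteq S_{n+m}$; every permutation of $S_{n+m}$ with $m$ fixed points is written uniquely in this form, with $\sigma$ its derangement part (delete fixed points and standardize). Values of slots. For $\sigma\in\mathcal D_n$ and $0\le j\le n$, the $j$-th slot is green if $\mathrm{des}\langle\sigma,j\rangle=\mathrm{des}\,\sigma$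 and red if $\mathrm{des}\langle\sigma,j\rangle=\mathrm{des}\,\sigma+1$. If there are $g+1$ green slots, assign values $0,1,\dots,g$ to the green slots from right to left and $g+1,\dots,n$ to the red slots from left to right; $g_j$ is the value of the $j$-th slot. $\Psi$ is defined on each $S(\sigma,m)$ (hence on $S_N$) by induction on $m$: identity on $S(\sigma,0)$; $\Psi\langle\sigma,i\rangle=\langle\sigma,g_i\rangle$; for $m>1$ and $\tau=\langle\sigma,i_1,\dots,i_m\rangle$: if the $i_m$-th slot is green and $\Psi\langle\sigma,i_1,\dots,i_{m-1}\rangle=\langle\sigma,j_2,\dots,j_m\rangle$, then $\Psi(\tau)=\langle\sigma,g_{i_m},j_2,\dots,j_m\rangle$. If it is red, let $k$ be the smallest positive integer with $i_{m-k}<i_m$ ($k=m$ if none). If $k=m$, $\Psi(\tau)=\langle\sigma,(g_{i_m}-i_m)^{(m-1\text{ times})},g_{i_m}\rangle$; if $k<m$ and $\Psi\langle\sigma,i_1,\dots,i_{m-k}\rangle=\langle\sigma,j_1,\dots,j_{m-k}\rangle$, then $\Psi(\tau)=\langle\sigma,(g_{i_m}-i_m)^{(k-1\text{ times})},j_1+1,\dots,j_{m-k}+1,g_{i_m}\rangle$. $\mathrm{ZDer}$. For $\sigma\in S_n$, $\mathrm{ZDer}(\sigma)$ is the word obtained by replacing each fixed point by $0$ and each other letter $x$ by its rank among the non-fixed letters. For $0\le m\le n$ and a word $v$ of length $m$, $\mathrm{Sh}(0^{n-m}v)$ is the set of shuffles of $0^{n-m}$ and $v$; $\mathcal S_n^{\mathrm{Der}}=\bigcup_{0\le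 m\le n,\ v\in\mathcal D_m}\mathrm{Sh}(0^{n-m}v)$. $\mathrm{ZDer}:S_n\to\mathcal S_n^{\mathrm{Der}}$ is a bijection. $\mathbf\Phi$. Let $v\in\mathcal D_m$, $w=x_1\cdots x_n\in\mathrm{Sh}(0^{n-m}v)$ with nonzero letters at positions $j_1<\dots<j_m$, rank the increasing bijection $\{j_1,\dots,j_m\}\to[m]$. A positive letter $x_k$ is excedent if $x_k>\mathrm{rank}(k)$, subexcedent if $x_k<\mathrm{rank}(k)$; non-subexcedent means $0$ or excedent; $x_0=x_{n+1}=+\infty$ (non-subexcedent). For $1\le l\le n$ define $\phi_l$ on $\mathrm{Sh}(0^{n-m}v)$: if $l>n-m$, $\phi_l(w)=w$. Otherwise let $x_j$ be the $l$-th zero of $w$ from the left. (1) If $x_{j-1},x_{j+1}$ are both non-subexcedent, $\phi_l(w)=w$. (2) If $x_{j-1}$ is non-subexcedent and $x_{j+1}$ subexcedent, or both are subexcedent with $x_{j-1}>x_{j+1}$: take the greatest $k\ge j+1$ with $x_{j+1}<x_{j+2}<\dots<x_k<\mathrm{rank}(k)$ and set $\phi_l(w)=x_1\cdots x_{j-1}x_{j+1}\cdots x_k\,0\,x_{k+1}\cdots x_n$. (3) If $x_{j-1}$ is subexcedent and $x_{j+1}$ non-subexcedent, or both subexcedent with $x_{j-1}<x_{j+1}$: take the smallest $i\le j-1$ with $\mathrm{rank}(i)>x_i>x_{i+1}>\dots>x_{j-1}$ and set $\phi_l(w)=x_1\cdots x_{i-1}\,0\,x_i\cdots x_{j-1}x_{j+1}\cdots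 x_n$. Then $\mathbf\Phi=\phi_1\circ\phi_2\circ\cdots\circ\phi_n$, a bijection of each $\mathrm{Sh}(0^{n-m}v)$ onto itself. $\mathbf F$. $\mathbf F$ maps words of nonnegative integers to words in the same shuffle class. If $w$ has length $1$ or $\mathrm{des}\,w=0$, $\mathbf F(w)=w$. Otherwise (length $n\ge2$, $\mathrm{des}\,w\ge1$) write $w=w'a0^rb$ with $b$ the last letter, $a\ge1$, $r\ge0$. (1) If $a\le b$: $\mathbf F(w)=\mathbf F(w'a0^r)\,b$. (2) If $a>b$ and $r\ge1$: writing $\mathbf F(w'a0^r)=w''0$, $\mathbf F(w)=0w''b$. (3) If $a>b$ and $r=0$: writing $\mathbf F(w'a)=0^{m_1}x_1v_10^{m_2}x_2v_2\cdots0^{m_k}x_kv_k$ with $m_1\ge0$, $m_2,\dots,m_k>0$, $x_i$ positive letters and $v_i$ (possibly empty) words of positive letters, $\mathbf F(w)=x_10^{m_1}v_1x_20^{m_2}v_2\cdots x_k0^{m_k}v_k\,b$. -}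

module Defs where

open import Data.Nat using (ℕ; zero; suc; _+_; _∸_; _≤ᵇ_; _<ᵇ_; _≡ᵇ_; _≤_)
open import Data.Bool using (Bool; true; false; if_then_else_; _∧_; _∨_; not)
open import Data.List using (List; []; _∷_; [_]; _++_; map; length; take; drop; reverse;
  foldl; foldr; replicate; upTo; filterᵇ; takeWhileᵇ; dropWhileᵇ)
open import Data.List.Relation.Unary.All using (All)
open import Data.List.Relation.Binary.Permutation.Propositional using (_↭_)
open import Data.Product using (_×_; _,_; proj₁; proj₂)
open import Relation.Binary.PropositionalEquality using (_≢_)

-- Generic helpers on words (lists of naturals). Positions are 1-based.

range : ℕ → ℕ → List ℕ
range a n = map (a +_) (upTo n)

get0 : List ℕ → ℕ → ℕ
get0 []       _       = 0
get0 (x ∷ xs) zero    = x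
get0 (x ∷ xs) (suc p) = get0 xs p

-- 1-based lookup x_p (default 0 outside 1..length)
nth : List ℕ → ℕ → ℕ
nth w zero    = 0
nth w (suc p) = get0 w p

count : (ℕ → Bool) → List ℕ → ℕ
count p xs = length (filterᵇ p xs)

des : List ℕ → ℕ
des []           = 0
des (x ∷ [])     = 0
des (x ∷ y ∷ ys) = (if y <ᵇ x then 1 else 0) + des (y ∷ ys)

indexed : ℕ → List ℕ → List (ℕ × ℕ)
indexed k []       = []
indexed k (x ∷ xs) = (k , x) ∷ indexed (suc k) xs

IsPerm : ℕ → List ℕ → Set
IsPerm n σ = σ ↭ range 1 n

IsDerangement : ℕ → List ℕ → Set
IsDerangement n σ = IsPerm n σ × All (λ px → proj₁ px ≢ proj₂ px) (indexed 1 σ)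

-- positions i ∈ {0..n} with x_i ≠ i (x_0 = +∞), i.e. the slots (i,i+1), in order;
-- the j-th slot is the j-th element (0-based) of this list
slotList : List ℕ → List ℕ
slotList σ = 0 ∷ filterᵇ (λ i → not (nth σ i ≡ᵇ i)) (range 1 (length σ))

slotPos : List ℕ → ℕ → ℕ
slotPos σ j = get0 (slotList σ) j

bump : ℕ → ℕ → ℕ
bump i x = if x ≤ᵇ i then x else suc x

-- insert the new fixed point i+1 between positions i and i+1
insertAt : List ℕ → ℕ → List ℕ
insertAt σ i = map (bump i) (take i σ) ++ suc i ∷ map (bump i) (drop i σ)

ins : List ℕ → ℕ → List ℕ
ins σ j = insertAt σ (slotPos σ j)

insertSeq : List ℕ → List ℕ → List ℕ
insertSeq σ js = foldl ins σ js

-- Green/red slots and their values (σ a derangement of [n], slots 0..n)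

isGreen : List ℕ → ℕ → Bool
isGreen σ j = des (ins σ j) ≡ᵇ des σ

slotValue : List ℕ → ℕ → ℕ
slotValue σ j =
  if isGreen σ j
  then count (λ j' → isGreen σ j' ∧ (j <ᵇ j')) allSlots
  else count (isGreen σ) allSlots + count (λ j' → not (isGreen σ j') ∧ (j' <ᵇ j)) allSlots
  where
  allSlots : List ℕ
  allSlots = upTo (suc (length σ))

-- Ψ on S(σ, m):  Ψ⟨σ, i₁,…,i_m⟩ = ⟨σ, ΨSeq σ (i₁ ∷ … ∷ i_m)⟩.
-- psiRev takes the sequence reversed (i_m ∷ i_{m-1} ∷ … ∷ i₁); first argument is fuel.

psiRev : ℕ → List ℕ → List ℕ → List ℕ
psiRev zero    σ _          = []
psiRev (suc f) σ []         = []
psiRev (suc f) σ (i ∷ rest) =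
  if isGreen σ i
  then slotValue σ i ∷ psiRev f σ rest
  else replicate (length (takeWhileᵇ (i ≤ᵇ_) rest)) (slotValue σ i ∸ i)
       ++ map suc (psiRev f σ (dropWhileᵇ (i ≤ᵇ_) rest))
       ++ [ slotValue σ i ]

ΨSeq : List ℕ → List ℕ → List ℕ
ΨSeq σ is = psiRev (suc (length is)) σ (reverse is)

Ψ : List ℕ → List ℕ → List ℕ
Ψ σ is = insertSeq σ (ΨSeq σ is)

ZDer : List ℕ → List ℕ
ZDer σ = map letter (indexed 1 σ)
  where
  nonFixed : List ℕ
  nonFixed = map proj₂ (filterᵇ (λ px → not (proj₁ px ≡ᵇ proj₂ px)) (indexed 1 σ))
  letter : ℕ × ℕ → ℕ
  letter (p , x) = if p ≡ᵇ x then 0 else suc (count (_<ᵇ x) nonFixed)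

rank : List ℕ → ℕ → ℕ
rank w p = count (λ x → not (x ≡ᵇ 0)) (take p w)

-- is position p subexcedent? (positions 0 and n+1 carry +∞: not subexcedent)
isSub : List ℕ → ℕ → Bool
isSub w p = not (p ≡ᵇ 0) ∧ (p ≤ᵇ length w) ∧ not (nth w p ≡ᵇ 0) ∧ (nth w p <ᵇ rank w p)

zeroPositions : List ℕ → List ℕ
zeroPositions w = filterᵇ (λ p → nth w p ≡ᵇ 0) (range 1 (length w))

-- greatest k ≥ j+1 with x_{j+1} < … < x_k < rank(k); call with p = best = j+1
scanUp : ℕ → List ℕ → ℕ → ℕ → ℕ
scanUp zero    w p best = best
scanUp (suc f) w p best =
  if (suc p ≤ᵇ length w) ∧ (nth w p <ᵇ nth w (suc p))
  then scanUp f w (suc p) (if nth w (suc p) <ᵇ rank w (suc p) then suc p else best)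
  else best

-- smallest i ≤ j-1 with rank(i) > x_i > … > x_{j-1}; call with p = best = j-1
scanDown : ℕ → List ℕ → ℕ → ℕ → ℕ
scanDown zero    w p best = best
scanDown (suc f) w p best =
  if (2 ≤ᵇ p) ∧ (nth w p <ᵇ nth w (p ∸ 1))
  then scanDown f w (p ∸ 1) (if nth w (p ∸ 1) <ᵇ rank w (p ∸ 1) then p ∸ 1 else best)
  else best

moveRight : List ℕ → ℕ → List ℕ
moveRight w j = take (j ∸ 1) w ++ take (k ∸ j) (drop j w) ++ 0 ∷ drop k w
  where
  k : ℕ
  k = scanUp (length w) w (suc j) (suc j)

moveLeft : List ℕ → ℕ → List ℕ
moveLeft w j = take (i ∸ 1) w ++ 0 ∷ take (j ∸ i) (drop (i ∸ 1) w) ++ drop j w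
  where
  i : ℕ
  i = scanDown (length w) w (j ∸ 1) (j ∸ 1)

φ : ℕ → List ℕ → List ℕ
φ l w =
  if (length (zeroPositions w) <ᵇ l) ∨ (l ≡ᵇ 0) then w
  else (if case2 then moveRight w j else (if case3 then moveLeft w j else w))
  where
  j : ℕ
  j = get0 (zeroPositions w) (l ∸ 1)
  sL sR : Bool
  sL = isSub w (j ∸ 1)
  sR = isSub w (suc j)
  xL xR : ℕ
  xL = nth w (j ∸ 1)
  xR = nth w (suc j)
  case2 case3 : Bool
  case2 = (not sL ∧ sR) ∨ (sL ∧ sR ∧ (xR <ᵇ xL))
  case3 = (sL ∧ not sR) ∨ (sL ∧ sR ∧ (xL <ᵇ xR))

Φ : List ℕ → List ℕ
Φ w = foldr φ w (range 1 (length w))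

-- 0^{m₁} x₁ v₁ 0^{m₂} x₂ v₂ ⋯  ↦  x₁ 0^{m₁} v₁ x₂ 0^{m₂} v₂ ⋯
mutual
  rearr : ℕ → List ℕ → List ℕ
  rearr z []           = replicate z 0
  rearr z (zero ∷ xs)  = rearr (suc z) xs
  rearr z (suc x ∷ xs) = suc x ∷ replicate z 0 ++ posRun xs

  posRun : List ℕ → List ℕ
  posRun []           = []
  posRun (zero ∷ xs)  = rearr 1 xs
  posRun (suc x ∷ xs) = suc x ∷ posRun xs

dropLast : List ℕ → List ℕ
dropLast u = reverse (drop 1 (reverse u))

Ffuel : ℕ → List ℕ → List ℕ
Ffuel zero w = w
Ffuel (suc f) w with reverse w
... | []        = w
... | b ∷ rinit with dropWhileᵇ (_≡ᵇ 0) rinit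
...   | []      = w
...   | a ∷ _   =
  if des w ≡ᵇ 0 then w
  else (if a ≤ᵇ b then u ++ [ b ]
        else (if 1 ≤ᵇ r then 0 ∷ dropLast u ++ [ b ]
              else rearr 0 u ++ [ b ]))
  where
  r : ℕ
  r = length (takeWhileᵇ (_≡ᵇ 0) rinit)
  u : List ℕ
  u = Ffuel f (reverse rinit)

F : List ℕ → List ℕ
F w = Ffuel (length w) w

{-
A word of Sh(0^m v), v = v₁ ⋯ vₙ, is given by the contents a₀, …, aₙ of its slots, aₛ being the number of zeros right
after vₛ.  Colour the slots with two colours and read them from left to right, keeping a multiset M of slots: a slot s of
the first colour with content p turns M into (M + 1) ∪ {0^p}; one of the second colour leaves M alone if p = 0 and turns
it into (M + 1) ∪ {0^(p-1), s} otherwise.  With the first colour given to the descents vₛ > vₛ₊₁ (v₀ = vₙ₊₁ = ∞) this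
computes the slots of 𝐅(w); with the first colour given to the green slots it computes Ψ, because a green slot has as
value the number of green slots to its right, and a red slot s has s plus that number.

The two colourings differ only at the ends of the maximal blocks of subexcedent letters: the slot before a block is a
descent but red, the slot after it an ascent but green.  A slot of the first colour may change places with a slot of the
second colour following it without changing the result, provided that the contents (p, 0) become (0, p) and (p, q + 1)
become (p + 1, q).  On each block 𝚽 is a composition of such exchanges, which turns the first colouring into the second.
-}

module Submission where

open import Defs
open import Data.Bool using (Bool; true; false; if_then_else_; _∧_; _∨_; not; T)
open import Data.Bool.Properties using (T?; ∧-identityʳ; ∧-zeroʳ)
open import Data.Empty using (⊥-elim)
open import Data.List hiding (sum; insertAt; last)
open import Data.List.Properties
open import Data.List.Relation.Binary.Permutation.Propositional using (_↭_; ↭-sym; ↭⇒↭ₛ)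
open import Data.List.Relation.Binary.Permutation.Propositional.Properties using (filter-↭; ↭-length; All-resp-↭)
open import Data.List.Relation.Binary.Permutation.Setoid.Properties using (Unique-resp-↭)
open import Data.List.Relation.Unary.All using (All; []; _∷_)
import Data.List.Relation.Unary.All as All
import Data.List.Relation.Unary.All.Properties as All
open import Data.List.Relation.Unary.Linked using (Linked; []; [-]; _∷_)
import Data.List.Relation.Unary.Linked as Linked
open import Data.List.Relation.Unary.Linked.Properties using (AllPairs⇒Linked)
import Data.List.Relation.Unary.Unique.Propositional.Properties as Unique
open import Data.Nat
open import Data.Nat.ListAction using (sum)
open import Data.Nat.Properties
open import Data.Product using (_×_; _,_; proj₁; proj₂; ∃; ∃₂)
open import Function using (_∘_; id; flip)
open import Relation.Binary using (tri<; tri≈; tri>)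
open import Relation.Binary.PropositionalEquality hiding ([_])
open import Relation.Nullary using (yes; no)

-- The inverse of `Φ` is never formed. A word `w` with `Φ w` given is recovered in two halves: its
-- letters because `Φ` moves only zeros, its contents because `hat` describes `Φ` on contents.
-- Multisets suffice for Ψ because the contents reached by a sequence of insertions depend only on
-- how often each slot is chosen. As a list of multiplicities, M + 1 is M with a new head, and the
-- slot s just read is always the last entry; the two colours thus act at different ends of the
-- list, which is the source of the exchange law. On a block the colours 1 d ... d' 2 must become 2
-- d ... d' 1 with the inner ones kept. At an inner ascent the leading 1 is exchanged at once and
-- carried on; at an inner descent the rest of the block is treated before the exchange, since only
-- then does a 2 follow. `hat` is this recursion. The difficulty is that 𝚽 is defined one zero at a
-- time, the rightmost zero first, and that a zero may travel either way. Hence `hat` is compared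
-- with 𝚽 by adding single zeros to a slot.

true≢false : ∀ {A : Set} {b} → b ≡ true → b ≡ false → A
true≢false refl ()

<ᵇ-true : ∀ {m n} → m < n → (m <ᵇ n) ≡ true
<ᵇ-true {m} {n} p with m <ᵇ n in eq
... | true  = refl
... | false = ⊥-elim (subst T eq (<⇒<ᵇ p))

true-< : ∀ {m n} → (m <ᵇ n) ≡ true → m < n
true-< {m} {n} eq = <ᵇ⇒< m n (subst T (sym eq) _)

<ᵇ-false : ∀ {m n} → n ≤ m → (m <ᵇ n) ≡ false
<ᵇ-false {m} {n} p with m <ᵇ n in eq
... | false = refl
... | true  = ⊥-elim (≤⇒≯ p (true-< eq))

false-≥ : ∀ {m n} → (m <ᵇ n) ≡ false → n ≤ m
false-≥ eq = ≮⇒≥ λ p → true≢false (<ᵇ-true p) eq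

seq : ℕ → ℕ → List ℕ
seq a zero    = []
seq a (suc n) = a ∷ seq (suc a) n

range≡seq : ∀ a n → range a n ≡ seq a n
range≡seq a n = go n a id λ i → refl
  where
  go : ∀ n b (f : ℕ → ℕ) → (∀ i → a + f i ≡ b + i) → map (a +_) (applyUpTo f n) ≡ seq b n
  go zero    b f h = refl
  go (suc n) b f h = cong₂ _∷_ (trans (h 0) (+-identityʳ b))
    (go n (suc b) (f ∘ suc) λ i → trans (h (suc i)) (+-suc b i))

-- The maps φ_l on a word pre ʳ++ 0 ∷ u: the part of the word left of the moving zero is kept reversed.

nz : ℕ → Bool
nz x = not (x ≡ᵇ 0)

letters zeros : List ℕ → ℕ
letters = count nz
zeros   = count (_≡ᵇ 0)

get0-ʳ++ : ∀ pre k u → get0 (pre ʳ++ u) (length pre + k) ≡ get0 u k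
get0-ʳ++ []        k u = refl
get0-ʳ++ (x ∷ pre) k u =
  trans (cong (get0 (pre ʳ++ x ∷ u)) (sym (+-suc (length pre) k))) (get0-ʳ++ pre (suc k) (x ∷ u))

take-ʳ++ : ∀ pre k (u : List ℕ) → take (length pre + k) (pre ʳ++ u) ≡ pre ʳ++ take k u
take-ʳ++ []        k u = refl
take-ʳ++ (x ∷ pre) k u =
  trans (cong (λ i → take i (pre ʳ++ x ∷ u)) (sym (+-suc (length pre) k))) (take-ʳ++ pre (suc k) (x ∷ u))

drop-ʳ++ : ∀ pre k (u : List ℕ) → drop (length pre + k) (pre ʳ++ u) ≡ drop k u
drop-ʳ++ []        k u = refl
drop-ʳ++ (x ∷ pre) k u =
  trans (cong (λ i → drop i (pre ʳ++ x ∷ u)) (sym (+-suc (length pre) k))) (drop-ʳ++ pre (suc k) (x ∷ u))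

hd : List ℕ → ℕ
hd []      = 0
hd (x ∷ _) = x

get0-zero : ∀ u → get0 u 0 ≡ hd u
get0-zero []      = refl
get0-zero (x ∷ u) = refl

nth-ʳ++ : ∀ pre u → nth (pre ʳ++ u) (suc (length pre)) ≡ hd u
nth-ʳ++ pre u = trans (cong (get0 (pre ʳ++ u)) (sym (+-identityʳ _)))
  (trans (get0-ʳ++ pre 0 u) (get0-zero u))

count-∷ : ∀ p x xs → count p (x ∷ xs) ≡ (if p x then 1 else 0) + count p xs
count-∷ p x xs with p x
... | true  = refl
... | false = refl

count-ʳ++ : ∀ p pre u → count p (pre ʳ++ u) ≡ count p pre + count p u
count-ʳ++ p []        u = refl
count-ʳ++ p (x ∷ pre) u rewrite count-ʳ++ p pre (x ∷ u) with p x
... | true  = +-suc _ _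
... | false = refl

rank-ʳ++ : ∀ pre u → rank (pre ʳ++ u) (suc (length pre)) ≡ letters pre + letters (take 1 u)
rank-ʳ++ pre u = trans
  (cong letters (trans (cong (λ i → take i (pre ʳ++ u)) (+-comm 1 (length pre))) (take-ʳ++ pre 1 u)))
  (count-ʳ++ nz pre (take 1 u))

-- sub L y: the letter y, preceded by L letters, is subexcedent.
sub : ℕ → ℕ → Bool
sub L y = nz y ∧ (y <ᵇ suc L)

subL : List ℕ → Bool
subL []        = false
subL (y ∷ pre) = sub (letters pre) y

subR : ℕ → List ℕ → Bool
subR L []      = false
subR L (y ∷ _) = sub L y

<ᵇ-rank : ∀ x pre y u → (x <ᵇ y) ≡ true →
  (y <ᵇ rank (pre ʳ++ y ∷ u) (suc (length pre))) ≡ (y <ᵇ suc (letters pre))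
<ᵇ-rank x pre (suc y) u eq rewrite rank-ʳ++ pre (suc y ∷ u) | +-comm (letters pre) 1 = refl

≤ᵇ-true : ∀ {m n} → m ≤ n → (m ≤ᵇ n) ≡ true
≤ᵇ-true {zero}  _ = refl
≤ᵇ-true {suc m} p = <ᵇ-true p

≤ᵇ-false : ∀ {m n} → n < m → (m ≤ᵇ n) ≡ false
≤ᵇ-false {suc m} (s≤s p) = <ᵇ-false p

isSub-ʳ++ : ∀ pre u → isSub (pre ʳ++ u) (suc (length pre)) ≡ subR (letters pre) u
isSub-ʳ++ pre [] rewrite length-ʳ++ pre {[]} | +-identityʳ (length pre)
  | <ᵇ-false {length pre} {length pre} ≤-refl = refl
isSub-ʳ++ pre (y ∷ u)
  rewrite length-ʳ++ pre {y ∷ u}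
        | <ᵇ-true {length pre} {length pre + suc (length u)} (m<m+n _ z<s)
        | nth-ʳ++ pre (y ∷ u) with y
... | zero  = refl
... | suc y' rewrite rank-ʳ++ pre (suc y' ∷ u) | +-comm (letters pre) 1 = refl

-- The number of letters which a zero passes when it moves right, x being the letter last passed.
climb : ℕ → ℕ → List ℕ → ℕ
climb x L []      = 0
climb x L (y ∷ u) = if (x <ᵇ y) ∧ (y <ᵇ suc L) then suc (climb y (suc L) u) else 0

sink : ℕ → List ℕ → ℕ
sink x []        = 0
sink x (y ∷ pre) = if (x <ᵇ y) ∧ (y <ᵇ suc (letters pre)) then suc (sink y pre) else 0

push : ℕ → List ℕ → List ℕ → List ℕ
push x pre u = pre ʳ++ (take n u ++ 0 ∷ drop n u)
  where
  n : ℕ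
  n = climb x (letters pre) u

pull : ℕ → List ℕ → List ℕ → List ℕ
pull x pre u = drop n pre ʳ++ 0 ∷ (take n pre ʳ++ u)
  where
  n : ℕ
  n = sink x pre

letters-pos : ∀ x y pre → (x <ᵇ y) ≡ true → letters (y ∷ pre) ≡ suc (letters pre)
letters-pos x (suc y) pre _ = refl

-- Beyond a letter x that is not subexcedent an increasing run has no subexcedent letter.
scanUp-stop : ∀ f P x u best → 0 < x → letters P < x →
  scanUp f (P ʳ++ x ∷ u) (suc (length P)) best ≡ best
scanUp-stop zero    P x u best 0<x L<x = refl
scanUp-stop (suc f) P x [] best 0<x L<x
  rewrite length-ʳ++ P {x ∷ []} | +-comm (length P) 1
        | <ᵇ-false {length P} {length P} ≤-refl = refl
scanUp-stop (suc f) P x@(suc _) (y ∷ u) best 0<x L<x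
  rewrite nth-ʳ++ P (x ∷ y ∷ u) | nth-ʳ++ (x ∷ P) (y ∷ u)
        | length-ʳ++ P {x ∷ y ∷ u}
        | <ᵇ-true {suc (length P)} {length P + suc (suc (length u))}
            (subst (suc (length P) <_) (sym (trans (+-suc _ _) (cong suc (+-suc _ _)))) (s≤s (s≤s (m≤m+n _ _))))
  with x <ᵇ y in eq
... | false = refl
... | true
  rewrite <ᵇ-rank x (x ∷ P) y u eq
        | <ᵇ-false {y} {suc (suc (letters P))} (<-≤-trans (s≤s L<x) (true-< eq))
  = scanUp-stop f (x ∷ P) y u best (≤-<-trans z≤n (true-< eq)) (<-≤-trans (s≤s L<x) (true-< eq))

-- `scanUp` follows the whole increasing run and remembers its last subexcedent letter, whereas
-- `climb` halts at the first letter that is not subexcedent. By `scanUp-stop` nothing is remembered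
-- from there on, so both reach the same place.
scanUp-climb : ∀ f P x u → 0 < x → length u ≤ f →
  scanUp f (P ʳ++ x ∷ u) (suc (length P)) (suc (length P)) ≡ suc (length P) + climb x (letters (x ∷ P)) u
scanUp-climb zero    P x [] _ _ = sym (+-identityʳ _)
scanUp-climb (suc f) P x [] _ _
  rewrite length-ʳ++ P {x ∷ []} | +-comm (length P) 1
        | <ᵇ-false {length P} {length P} ≤-refl = sym (+-identityʳ _)
scanUp-climb (suc f) P x@(suc _) (y ∷ u) 0<x (s≤s ≤f)
  rewrite nth-ʳ++ P (x ∷ y ∷ u) | nth-ʳ++ (x ∷ P) (y ∷ u)
        | length-ʳ++ P {x ∷ y ∷ u}
        | <ᵇ-true {suc (length P)} {length P + suc (suc (length u))}
            (subst (suc (length P) <_) (sym (trans (+-suc _ _) (cong suc (+-suc _ _)))) (s≤s (s≤s (m≤m+n _ _))))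
  with x <ᵇ y in eq
... | false = sym (+-identityʳ _)
... | true
  rewrite <ᵇ-rank x (x ∷ P) y u eq
  with y <ᵇ suc (suc (letters P)) in eq₂
... | true  = trans (scanUp-climb f (x ∷ P) y u (≤-<-trans z≤n (true-< eq)) ≤f)
    (trans (cong (λ k → suc (suc (length P)) + climb y k u) (letters-pos x y (x ∷ P) eq))
    (sym (+-suc (suc (length P)) (climb y (suc (letters (x ∷ P))) u))))
... | false = trans (scanUp-stop f (x ∷ P) y u _ (≤-<-trans z≤n (true-< eq)) (false-≥ eq₂)) (sym (+-identityʳ _))

-- In this direction the letters grow while their ranks fall, so the run contains no subexcedent
-- letter beyond one that is not.
scanDown-stop : ∀ f P x u best → letters P < x →
  scanDown f (P ʳ++ x ∷ u) (suc (length P)) best ≡ best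
scanDown-stop zero    P x u best L<x = refl
scanDown-stop (suc f) [] x u best L<x = refl
scanDown-stop (suc f) (y ∷ P) x u best L<x
  rewrite nth-ʳ++ (y ∷ P) (x ∷ u) | nth-ʳ++ P (y ∷ x ∷ u)
  with x <ᵇ y in eq
... | false = refl
... | true
  rewrite <ᵇ-rank x P y (x ∷ u) eq
        | <ᵇ-false {y} {suc (letters P)}
            (≤-trans (subst (_≤ x) (letters-pos x y P eq) (<⇒≤ L<x)) (<⇒≤ (true-< eq)))
  = scanDown-stop f P y (x ∷ u) best
      (≤-trans (subst (_≤ x) (letters-pos x y P eq) (<⇒≤ L<x)) (<⇒≤ (true-< eq)))

scanDown-sink : ∀ f P x u → length P ≤ f →
  scanDown f (P ʳ++ x ∷ u) (suc (length P)) (suc (length P)) ≡ suc (length (drop (sink x P) P))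
scanDown-sink zero    [] x u _ = refl
scanDown-sink (suc f) [] x u _ = refl
scanDown-sink (suc f) (y ∷ P) x u (s≤s ≤f)
  rewrite nth-ʳ++ (y ∷ P) (x ∷ u) | nth-ʳ++ P (y ∷ x ∷ u)
  with x <ᵇ y in eq
... | false = refl
... | true
  rewrite <ᵇ-rank x P y (x ∷ u) eq
  with y <ᵇ suc (letters P) in eq₂
... | true  = scanDown-sink f P y (x ∷ u) ≤f
... | false = scanDown-stop f P y (x ∷ u) _ (false-≥ eq₂)

sub-parts : ∀ {L y} → sub L y ≡ true → 0 < y × y ≤ L
sub-parts {L} {suc y} e = z<s , s≤s⁻¹ (true-< e)

climb-sub : ∀ L y u → sub L y ≡ true → climb 0 L (y ∷ u) ≡ suc (climb y (suc L) u)
climb-sub L (suc y) u e rewrite e = refl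

sink-sub : ∀ y P → sub (letters P) y ≡ true → sink 0 (y ∷ P) ≡ suc (sink y P)
sink-sub (suc y) P e rewrite e = refl

take-len : ∀ pre (u : List ℕ) → take (length pre) (pre ʳ++ u) ≡ pre ʳ++ []
take-len pre u = trans (cong (λ i → take i (pre ʳ++ u)) (sym (+-identityʳ _))) (take-ʳ++ pre 0 u)

-- The scan takes its first letter for granted, whereas `climb` tests it like all others; the
-- hypothesis on `u` makes this test succeed. The starting value 0 lies below every letter and so
-- imposes no order condition on the first one.
moveRight-push : ∀ pre u → subR (letters pre) u ≡ true →
  moveRight (pre ʳ++ 0 ∷ u) (suc (length pre)) ≡ push 0 pre u
moveRight-push pre (y ∷ u) e = begin
  take (length pre) w ++ take (k ∸ suc (length pre)) (drop (suc (length pre)) w) ++ 0 ∷ drop k w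
    ≡⟨ cong (λ k → take (length pre) w ++ take (k ∸ suc (length pre)) (drop (suc (length pre)) w) ++ 0 ∷ drop k w) k-eq ⟩
  take (length pre) w ++ take (suc (length pre) + n ∸ suc (length pre)) (drop (suc (length pre)) w) ++ 0 ∷ drop (suc (length pre) + n) w
    ≡⟨ cong₂ _++_ (take-len pre (0 ∷ y ∷ u))
        (cong₂ (λ a b → a ++ 0 ∷ b)
          (cong₂ take (m+n∸m≡n (suc (length pre)) n) drop-j)
          (drop-ʳ++ (0 ∷ pre) n (y ∷ u))) ⟩
  (pre ʳ++ []) ++ take n (y ∷ u) ++ 0 ∷ drop n (y ∷ u)
    ≡⟨ sym (ʳ++-defn pre) ⟩
  push 0 pre (y ∷ u) ∎
  where
  open ≡-Reasoning
  w = pre ʳ++ 0 ∷ y ∷ u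
  n = climb 0 (letters pre) (y ∷ u)
  k = scanUp (length w) w (suc (suc (length pre))) (suc (suc (length pre)))
  drop-j : drop (suc (length pre)) w ≡ y ∷ u
  drop-j = trans (cong (λ i → drop i w) (sym (+-identityʳ (suc (length pre))))) (drop-ʳ++ (0 ∷ pre) 0 (y ∷ u))
  enough : length u ≤ length w
  enough = subst (length u ≤_) (sym (length-ʳ++ pre {0 ∷ y ∷ u})) (≤-trans (m≤n+m _ 2) (m≤n+m _ (length pre)))
  k-eq : k ≡ suc (length pre) + n
  k-eq = begin
    k ≡⟨ scanUp-climb (length w) (0 ∷ pre) y u (proj₁ (sub-parts {letters pre} {y} e)) enough ⟩
    suc (suc (length pre)) + climb y (letters (y ∷ 0 ∷ pre)) u
      ≡⟨ cong (λ i → suc (suc (length pre)) + climb y i u)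
           (letters-pos 0 y (0 ∷ pre) (<ᵇ-true (proj₁ (sub-parts {letters pre} {y} e)))) ⟩
    suc (suc (length pre)) + climb y (suc (letters pre)) u
      ≡⟨ sym (+-suc (suc (length pre)) _) ⟩
    suc (length pre) + suc (climb y (suc (letters pre)) u)
      ≡⟨ cong (suc (length pre) +_) (sym (climb-sub (letters pre) y u e)) ⟩
    suc (length pre) + n ∎

moveLeft-pull : ∀ pre u → subL pre ≡ true →
  moveLeft (pre ʳ++ 0 ∷ u) (suc (length pre)) ≡ pull 0 pre u
moveLeft-pull pre@(y ∷ P) u e = begin
  take (i ∸ 1) w ++ 0 ∷ take (suc (length pre) ∸ i) (drop (i ∸ 1) w) ++ drop (suc (length pre)) w
    ≡⟨ cong₂ (λ i d → take (i ∸ 1) w ++ 0 ∷ take (suc (length pre) ∸ i) (drop (i ∸ 1) w) ++ d) i-eq drop-j ⟩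
  take (length B) w ++ 0 ∷ take (length pre ∸ length B) (drop (length B) w) ++ u
    ≡⟨ cong (λ w → take (length B) w ++ 0 ∷ take (length pre ∸ length B) (drop (length B) w) ++ u) w-eq ⟩
  take (length B) (B ʳ++ A ʳ++ 0 ∷ u) ++ 0 ∷ take (length pre ∸ length B) (drop (length B) (B ʳ++ A ʳ++ 0 ∷ u)) ++ u
    ≡⟨ cong₂ (λ a b → a ++ 0 ∷ b ++ u) (take-len B _)
        (trans (cong₂ take len-A (trans (cong (λ i → drop i (B ʳ++ A ʳ++ 0 ∷ u)) (sym (+-identityʳ (length B)))) (drop-ʳ++ B 0 _)))
          (take-len A (0 ∷ u))) ⟩
  (B ʳ++ []) ++ 0 ∷ (A ʳ++ []) ++ u
    ≡⟨ cong (λ a → (B ʳ++ []) ++ 0 ∷ a) (sym (ʳ++-defn A)) ⟩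
  (B ʳ++ []) ++ 0 ∷ (A ʳ++ u)
    ≡⟨ sym (ʳ++-defn B) ⟩
  pull 0 pre u ∎
  where
  open ≡-Reasoning
  w = pre ʳ++ 0 ∷ u
  n = sink 0 pre
  A = take n pre
  B = drop n pre
  i = scanDown (length w) w (length pre) (length pre)
  split : A ++ B ≡ pre
  split = take++drop≡id n pre
  w-eq : w ≡ B ʳ++ A ʳ++ 0 ∷ u
  w-eq = trans (cong (_ʳ++ 0 ∷ u) (sym split)) (++-ʳ++ A)
  len-A : length pre ∸ length B ≡ length A
  len-A = trans (cong (λ l → length l ∸ length B) (sym split))
    (trans (cong (_∸ length B) (length-++ A)) (m+n∸n≡m (length A) (length B)))
  drop-j : drop (suc (length pre)) w ≡ u
  drop-j = trans (cong (λ i → drop i w) (sym (+-identityʳ (suc (length pre))))) (drop-ʳ++ (0 ∷ pre) 0 u)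
  enough : length P ≤ length w
  enough = subst (length P ≤_) (sym (length-ʳ++ P {y ∷ 0 ∷ u})) (m≤m+n _ _)
  i-eq : i ≡ suc (length B)
  i-eq = trans (scanDown-sink (length w) P y (0 ∷ u) enough)
    (cong (λ k → suc (length (drop k pre))) (sym (sink-sub y P e)))

-- Locating the l-th zero, and the case distinction of `φ`.

filter-positions : ∀ (Q : ℕ → ℕ → Bool) pre u →
  filterᵇ (λ p → Q (nth (pre ʳ++ u) p) p) (seq (suc (length pre)) (length u)) ≡
  map proj₁ (filterᵇ (λ (p , x) → Q x p) (indexed (suc (length pre)) u))
filter-positions Q pre []      = refl
filter-positions Q pre (x ∷ u) rewrite nth-ʳ++ pre (x ∷ u) with Q x (suc (length pre))
... | true  = cong (suc (length pre) ∷_) (filter-positions Q (x ∷ pre) u)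
... | false = filter-positions Q (x ∷ pre) u

zeroIndices : ℕ → List ℕ → List ℕ
zeroIndices k w = map proj₁ (filterᵇ (λ (_ , x) → x ≡ᵇ 0) (indexed k w))

zeroPositions-eq : ∀ w → zeroPositions w ≡ zeroIndices 1 w
zeroPositions-eq w rewrite range≡seq 1 (length w) = filter-positions (λ x _ → x ≡ᵇ 0) [] w

length-zeroIndices : ∀ k w → length (zeroIndices k w) ≡ zeros w
length-zeroIndices k []          = refl
length-zeroIndices k (zero ∷ w)  = cong suc (length-zeroIndices (suc k) w)
length-zeroIndices k (suc x ∷ w) = length-zeroIndices (suc k) w

get0-zeroIndices : ∀ pre k u → get0 (zeroIndices k (pre ʳ++ u)) (zeros pre) ≡ get0 (zeroIndices (length pre + k) u) 0
get0-zeroIndices pre k u = trans (cong (get0 (zeroIndices k (pre ʳ++ u))) (sym (+-identityʳ (zeros pre)))) (go pre 0 u)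
  where
  go : ∀ pre i u → get0 (zeroIndices k (pre ʳ++ u)) (zeros pre + i) ≡ get0 (zeroIndices (length pre + k) u) i
  go []            i u = refl
  go (zero ∷ pre)  i u = trans (cong (get0 (zeroIndices k (pre ʳ++ 0 ∷ u))) (sym (+-suc (zeros pre) i))) (go pre (suc i) (0 ∷ u))
  go (suc x ∷ pre) i u = go pre i (suc x ∷ u)

choose : Bool → Bool → ℕ → ℕ → List ℕ → List ℕ → List ℕ → List ℕ
choose sL sR xL xR a b c =
  if (not sL ∧ sR) ∨ (sL ∧ sR ∧ (xR <ᵇ xL)) then a
  else if (sL ∧ not sR) ∨ (sL ∧ sR ∧ (xL <ᵇ xR)) then b else c

-- A move to the right occurs only with a subexcedent right neighbour, a move to the left only with
-- a subexcedent left one. Under just these hypotheses `moveRight` is `push` and `moveLeft` is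
-- `pull`.
choose-cong : ∀ sL sR xL xR {a a' b b' c} → (sR ≡ true → a ≡ a') → (sL ≡ true → b ≡ b') →
  choose sL sR xL xR a b c ≡ choose sL sR xL xR a' b' c
choose-cong false false xL xR f g = refl
choose-cong false true  xL xR f g = f refl
choose-cong true  false xL xR f g = g refl
choose-cong true  true  xL xR f g with xR <ᵇ xL | xL <ᵇ xR
... | true  | _     = f refl
... | false | true  = g refl
... | false | false = refl

move : List ℕ → ℕ → List ℕ
move w j = choose (isSub w (j ∸ 1)) (isSub w (suc j)) (nth w (j ∸ 1)) (nth w (suc j)) (moveRight w j) (moveLeft w j) w

φ-unfold : ∀ l w → φ l w ≡
  (if (length (zeroPositions w) <ᵇ l) ∨ (l ≡ᵇ 0) then w else move w (get0 (zeroPositions w) (l ∸ 1)))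
φ-unfold l w = refl

-- The default 0 of `hd` at the ends of the word is harmless: the two neighbours are compared only
-- if both are subexcedent, which `subL` and `subR` deny at the ends.
step : List ℕ → List ℕ → List ℕ
step pre u = choose (subL pre) (subR (letters pre) u) (hd pre) (hd u) (push 0 pre u) (pull 0 pre u) (pre ʳ++ 0 ∷ u)

isSub-before : ∀ pre u → isSub (pre ʳ++ u) (length pre) ≡ subL pre
isSub-before []        u = refl
isSub-before (y ∷ pre) u = isSub-ʳ++ pre (y ∷ u)

nth-before : ∀ pre u → nth (pre ʳ++ u) (length pre) ≡ hd pre
nth-before []        u = refl
nth-before (y ∷ pre) u = nth-ʳ++ pre (y ∷ u)

φ-step : ∀ pre u → φ (suc (zeros pre)) (pre ʳ++ 0 ∷ u) ≡ step pre u
φ-step pre u rewrite φ-unfold (suc (zeros pre)) (pre ʳ++ 0 ∷ u)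
  | zeroPositions-eq (pre ʳ++ 0 ∷ u)
  | length-zeroIndices 1 (pre ʳ++ 0 ∷ u)
  | count-ʳ++ (_≡ᵇ 0) pre (0 ∷ u)
  | <ᵇ-false {zeros pre + suc (zeros u)} {suc (zeros pre)} (subst (suc (zeros pre) ≤_) (sym (+-suc _ _)) (s≤s (m≤m+n _ _)))
  | get0-zeroIndices pre 1 (0 ∷ u)
  | +-comm (length pre) 1
  | isSub-before pre (0 ∷ u) | nth-before pre (0 ∷ u)
  | isSub-ʳ++ (0 ∷ pre) u | nth-ʳ++ (0 ∷ pre) u
  = choose-cong (subL pre) (subR (letters pre) u) (hd pre) (hd u) (moveRight-push pre u) (moveLeft-pull pre u)

φ-out : ∀ l w → zeros w < l → φ l w ≡ w
φ-out l w z<l rewrite φ-unfold l w | zeroPositions-eq w | length-zeroIndices 1 w | <ᵇ-true z<l = refl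

push-pass : ∀ x pre y u → (x <ᵇ y) ≡ true → (y <ᵇ suc (letters pre)) ≡ true →
  push x pre (y ∷ u) ≡ push y (y ∷ pre) u
push-pass x pre y u e₁ e₂ rewrite e₁ | e₂ | letters-pos x y pre e₁ = refl

pull-pass : ∀ x y pre u → (x <ᵇ y) ≡ true → (y <ᵇ suc (letters pre)) ≡ true →
  pull x (y ∷ pre) u ≡ pull y pre (y ∷ u)
pull-pass x y pre u e₁ e₂ rewrite e₁ | e₂ = refl

-- 𝚽 on slot contents

-- weave (a₀ ∷ … ∷ aₙ) (v₁ ∷ … ∷ vₙ) = 0^a₀ v₁ 0^a₁ ⋯ vₙ 0^aₙ
weave : List ℕ → List ℕ → List ℕ
weave []           v       = v
weave (suc p ∷ a)  v       = 0 ∷ weave (p ∷ a) v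
weave (zero ∷ a)   []      = []
weave (zero ∷ a)   (x ∷ v) = x ∷ weave a v

drops : ℕ → List ℕ → Bool
drops x []      = false
drops x (y ∷ _) = y <ᵇ x

-- The change of contents that makes up for exchanging the colours of a descending slot and an ascending slot next to it
-- (advance-swap).
sw₁ sw₂ : ℕ → ℕ → ℕ
sw₁ p zero    = 0
sw₁ p (suc q) = suc p
sw₂ p zero    = p
sw₂ p (suc q) = q

swapHead : ℕ → List ℕ → List ℕ
swapHead p []      = p ∷ []
swapHead p (q ∷ t) = sw₁ p q ∷ sw₂ p q ∷ t

-- 𝚽 read on the slot contents of a word whose nonzero letters v are preceded by r letters.
hat : ℕ → List ℕ → List ℕ → List ℕ
hat r (p ∷ q ∷ a) (x ∷ v) =
  if sub r x
  then (if drops x v then swapHead p (hat (suc r) (q ∷ a) v)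
        else sw₁ p q ∷ hat (suc r) (sw₂ p q ∷ a) v)
  else p ∷ hat (suc r) (q ∷ a) v
hat r a v = a

hat-length : ∀ r a v → length (hat r a v) ≡ length a
hat-length r []          v       = refl
hat-length r (p ∷ [])    v       = refl
hat-length r (p ∷ q ∷ a) []      = refl
hat-length r (p ∷ q ∷ a) (x ∷ v) with sub r x | drops x v
... | true  | true  = trans (swapHead-length p (hat (suc r) (q ∷ a) v)) (cong suc (hat-length (suc r) (q ∷ a) v))
  where
  swapHead-length : ∀ p t → length (swapHead p t) ≡ suc (length t)
  swapHead-length p []      = refl
  swapHead-length p (q ∷ t) = refl
... | true  | false = cong suc (hat-length (suc r) (sw₂ p q ∷ a) v)
... | false | _     = cong suc (hat-length (suc r) (q ∷ a) v)

hat-cons : ∀ r p a v → ∃₂ λ h c → hat r (p ∷ a) v ≡ h ∷ c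
hat-cons r p a v with hat r (p ∷ a) v | hat-length r (p ∷ a) v
... | h ∷ c | _ = h , c , refl

hat-desc : ∀ r p q a x v → sub r x ≡ true → drops x v ≡ true →
  hat r (p ∷ q ∷ a) (x ∷ v) ≡ swapHead p (hat (suc r) (q ∷ a) v)
hat-desc r p q a x v s d rewrite s | d = refl

hat-asc : ∀ r p q a x v → sub r x ≡ true → drops x v ≡ false →
  hat r (p ∷ q ∷ a) (x ∷ v) ≡ sw₁ p q ∷ hat (suc r) (sw₂ p q ∷ a) v
hat-asc r p q a x v s d rewrite s | d = refl

hat-exc : ∀ r p q a x v → sub r x ≡ false → hat r (p ∷ q ∷ a) (x ∷ v) ≡ p ∷ hat (suc r) (q ∷ a) v
hat-exc r p q a x v s rewrite s = refl

letters-sub : ∀ r x pre → sub r x ≡ true → letters (x ∷ pre) ≡ suc (letters pre)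
letters-sub r (suc x) pre _ = refl

nz-letters : ∀ x pre → 0 < x → letters (x ∷ pre) ≡ suc (letters pre)
nz-letters (suc x) pre _ = refl

nz-zeros : ∀ x pre → 0 < x → zeros (x ∷ pre) ≡ zeros pre
nz-zeros (suc x) pre _ = refl

push-stay : ∀ x pre u → climb x (letters pre) u ≡ 0 → push x pre u ≡ pre ʳ++ 0 ∷ u
push-stay x pre u e rewrite e = refl

climb-nonsub : ∀ L u → subR L u ≡ false → climb 0 L u ≡ 0
climb-nonsub L []          e = refl
climb-nonsub L (zero ∷ u)  e = refl
climb-nonsub L (suc y ∷ u) e rewrite e = refl

-- The exchanges imitate the climb letter by letter. The additional zero stays in front of a zero or
-- of a letter that is not subexcedent; at a descent with nothing behind the letter it passes that
-- one letter; at an ascent with an empty slot it passes and continues. These are the cases of `sw₁`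
-- and `sw₂`.
weave-hat-suc : ∀ pre p a v → length a ≡ length v → All (0 <_) v → Linked _≢_ v →
  pre ʳ++ weave (hat (letters pre) (suc p ∷ a) v) v ≡ push 0 pre (weave (hat (letters pre) (p ∷ a) v) v)
weave-hat-suc pre zero    [] [] _ _ _ = refl
weave-hat-suc pre (suc p) [] [] _ _ _ = refl
weave-hat-suc pre p (q ∷ a) (x ∷ v) len (0<x ∷ pos) adj with sub (letters pre) x in s
... | false = sym (push-stay 0 pre (weave (p ∷ rest) (x ∷ v)) (stay p))
  where
  rest = hat (suc (letters pre)) (q ∷ a) v
  stay : ∀ p → climb 0 (letters pre) (weave (p ∷ rest) (x ∷ v)) ≡ 0
  stay zero    = climb-nonsub (letters pre) (x ∷ weave rest v) s
  stay (suc p) = refl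
... | true with drops x v in d
weave-hat-suc pre p (q ∷ a) (x ∷ v) len (0<x ∷ pos) adj | true | true
  with hat (suc (letters pre)) (q ∷ a) v | hat-length (suc (letters pre)) (q ∷ a) v
... | suc q' ∷ t | _ = refl
... | zero ∷ t | _ = sym (trans
    (push-pass 0 pre x (weave (p ∷ t) v) (<ᵇ-true 0<x) (<ᵇ-true (s≤s (proj₂ (sub-parts {letters pre} {x} s)))))
    (push-stay x (x ∷ pre) (weave (p ∷ t) v) (stay p v d)))
  where
  stay : ∀ p v → drops x v ≡ true → climb x (letters (x ∷ pre)) (weave (p ∷ t) v) ≡ 0
  stay (suc p) v       d = refl
  stay zero    (y ∷ v) d rewrite <ᵇ-false {x} {y} (<⇒≤ (true-< d)) = refl
weave-hat-suc pre p (suc q ∷ a) (x ∷ v) len (0<x ∷ pos) adj | true | false = refl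
weave-hat-suc pre p (zero ∷ a) (x ∷ v) len (0<x ∷ pos) adj | true | false = begin
  (x ∷ pre) ʳ++ weave (hat (suc (letters pre)) (suc p ∷ a) v) v
    ≡⟨ cong (λ L → (x ∷ pre) ʳ++ weave (hat L (suc p ∷ a) v) v) (sym (nz-letters x pre 0<x)) ⟩
  (x ∷ pre) ʳ++ weave (hat (letters (x ∷ pre)) (suc p ∷ a) v) v
    ≡⟨ weave-hat-suc (x ∷ pre) p a v (suc-injective len) pos (Linked.tail adj) ⟩
  push 0 (x ∷ pre) (weave (hat (letters (x ∷ pre)) (p ∷ a) v) v)
    ≡⟨ cong (λ L → push 0 (x ∷ pre) (weave (hat L (p ∷ a) v) v)) (nz-letters x pre 0<x) ⟩
  push 0 (x ∷ pre) u
    ≡⟨ cong (λ n → (x ∷ pre) ʳ++ (take n u ++ 0 ∷ drop n u)) (same v d pos adj) ⟩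
  push x (x ∷ pre) u
    ≡⟨ sym (push-pass 0 pre x u (<ᵇ-true 0<x) (<ᵇ-true (s≤s (proj₂ (sub-parts {letters pre} {x} s))))) ⟩
  push 0 pre (x ∷ u) ∎
  where
  open ≡-Reasoning
  u = weave (hat (suc (letters pre)) (p ∷ a) v) v
  -- Neighbours differ, so without a descent the letter after `x` is larger than `x`; the climb may
  -- therefore forget `x` and restart from 0.
  same : ∀ v → drops x v ≡ false → All (0 <_) v → Linked _≢_ (x ∷ v) →
    let u = weave (hat (suc (letters pre)) (p ∷ a) v) v in
    climb 0 (letters (x ∷ pre)) u ≡ climb x (letters (x ∷ pre)) u
  same v d pos adj with hat (suc (letters pre)) (p ∷ a) v | hat-length (suc (letters pre)) (p ∷ a) v
  same v       d pos       adj         | suc h ∷ c | _ = refl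
  same []      d pos       adj         | zero ∷ c  | _ = refl
  same (y ∷ v) d (0<y ∷ _) (x≢y ∷ _)   | zero ∷ c  | _
    rewrite <ᵇ-true 0<y | <ᵇ-true (≤∧≢⇒< (false-≥ d) x≢y) = refl

-- No zero passes a zero or a letter that is not subexcedent, so an additional zero stays in the
-- first slot. It is needed for a zero that will leave to the left.
hat-suc-nonsub : ∀ r p a v h c → hat r (p ∷ a) v ≡ h ∷ c → subR r (weave (h ∷ c) v) ≡ false →
  length a ≡ length v → hat r (suc p ∷ a) v ≡ suc h ∷ c
hat-suc-nonsub r p [] [] h c refl n len = refl
hat-suc-nonsub r p (q ∷ a) (x ∷ v) h c e n len with sub r x in s
... | false = cong₂ _∷_ (cong suc (∷-injectiveˡ e)) (∷-injectiveʳ e)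
... | true with drops x v
hat-suc-nonsub r p (q ∷ a) (x ∷ v) h c e n len | true | true
  with hat (suc r) (q ∷ a) v | hat-length (suc r) (q ∷ a) v
hat-suc-nonsub r p (q ∷ a) (x ∷ v) _ _ refl n len | true | true | suc q' ∷ t | _ = refl
hat-suc-nonsub r p (q ∷ a) (x ∷ v) _ _ refl n len | true | true | zero ∷ t | _ = true≢false s n
hat-suc-nonsub r p (suc q ∷ a) (x ∷ v) _ _ refl n len | true | false = refl
hat-suc-nonsub r p (zero ∷ a) (x ∷ v) _ _ refl n len | true | false = true≢false s n

-- The first content is `sw₁` of `p` and the content behind `x`, the latter taken after `hat` at a
-- descent and before it at an ascent. It vanishes only if the second argument does, and then for
-- every `p`.
hat-suc-sub : ∀ r p a x v c → hat r (p ∷ a) (x ∷ v) ≡ 0 ∷ c → sub r x ≡ true →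
  length a ≡ suc (length v) → ∃ λ t → hat r (suc p ∷ a) (x ∷ v) ≡ 0 ∷ t
hat-suc-sub r p (q ∷ a) x v c e s len rewrite s with drops x v
hat-suc-sub r p (q ∷ a) x v c e s len | true
  with hat (suc r) (q ∷ a) v | hat-length (suc r) (q ∷ a) v
... | zero ∷ t | _ = _ , refl
hat-suc-sub r p (q ∷ a) x v c () s len | true | suc q' ∷ t | _
hat-suc-sub r p (zero ∷ a) x v c e s len | false = _ , refl

-- Subs X pre: the letters of X, which follow pre (both words reversed), are subexcedent.
data Subs : List ℕ → List ℕ → Set where
  []  : ∀ {pre} → Subs [] pre
  _∷_ : ∀ {x X pre} → sub (letters (X ++ pre)) x ≡ true → Subs X pre → Subs (x ∷ X) pre

replicate-shift : ∀ k {x : ℕ} l → replicate (suc k) x ++ l ≡ replicate k x ++ x ∷ l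
replicate-shift zero        l = refl
replicate-shift (suc k) {x} l = cong (x ∷_) (replicate-shift k l)

weave-ʳ++ : ∀ X c t → weave (replicate (length X) 0 ++ c) (X ʳ++ t) ≡ X ʳ++ weave c t
weave-ʳ++ []      c t = refl
weave-ʳ++ (x ∷ X) c t = trans
  (cong (λ l → weave l (X ʳ++ x ∷ t)) (replicate-shift (length X) c)) (weave-ʳ++ X (0 ∷ c) (x ∷ t))

-- Exchanging two empty contents changes nothing, so the empty slots of the block stay empty once
-- the slot behind it comes out empty.
hat-ʳ++ : ∀ X pre b t cs → Subs X pre → hat (letters (X ++ pre)) (0 ∷ b) t ≡ 0 ∷ cs →
  hat (letters pre) (replicate (length X) 0 ++ 0 ∷ b) (X ʳ++ t) ≡ replicate (length X) 0 ++ 0 ∷ cs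
hat-ʳ++ []      pre b t cs []       e = e
hat-ʳ++ (x ∷ X) pre b t cs (s ∷ ss) e
  rewrite replicate-shift (length X) {0} (0 ∷ b) | replicate-shift (length X) {0} (0 ∷ cs)
  = hat-ʳ++ X pre (0 ∷ b) (x ∷ t) (0 ∷ cs) ss inner
  where
  e' : hat (suc (letters (X ++ pre))) (0 ∷ b) t ≡ 0 ∷ cs
  e' = subst (λ L → hat L (0 ∷ b) t ≡ 0 ∷ cs) (letters-sub _ x (X ++ pre) s) e
  inner : hat (letters (X ++ pre)) (0 ∷ 0 ∷ b) (x ∷ t) ≡ 0 ∷ 0 ∷ cs
  inner rewrite s with drops x t
  ... | true  = cong (swapHead 0) e'
  ... | false = cong (0 ∷_) e'

weave-hat-ʳ++ : ∀ X pre b t cs → Subs X pre → hat (letters (X ++ pre)) (0 ∷ b) t ≡ 0 ∷ cs →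
  pre ʳ++ weave (hat (letters pre) (replicate (length X) 0 ++ 0 ∷ b) (X ʳ++ t)) (X ʳ++ t) ≡
  (X ++ pre) ʳ++ weave (0 ∷ cs) t
weave-hat-ʳ++ X pre b t cs ss e rewrite hat-ʳ++ X pre b t cs ss e | weave-ʳ++ X (0 ∷ cs) t
  = sym (++-ʳ++ X)

-- The place where a zero travelling left must halt: the start of the word, a zero, or a letter that
-- is not subexcedent.
Wall : List ℕ → Set
Wall pre = subL pre ≡ false

-- A slot content 1 whose zero has just passed x travels on to the left as long as the letters increase.
weave-hat-pull : ∀ X pre x b t cs → Subs X pre → Wall pre →
  hat (letters (X ++ pre)) (0 ∷ b) (x ∷ t) ≡ 1 ∷ cs →
  pre ʳ++ weave (hat (letters pre) (replicate (length X) 0 ++ 0 ∷ b) (X ʳ++ x ∷ t)) (X ʳ++ x ∷ t) ≡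
  pull x (X ++ pre) (x ∷ weave cs t)
weave-hat-pull [] [] x b t cs [] w e rewrite e = refl
weave-hat-pull [] (y ∷ P) x b t cs [] w e rewrite e with x <ᵇ y in l
... | false = refl
weave-hat-pull [] (suc y ∷ P) x b t cs [] w e | true rewrite w = refl
weave-hat-pull (z ∷ X) pre x b t cs (s ∷ ss) w e with x <ᵇ z in l
... | true = trans
  (trans (cong (λ l → pre ʳ++ weave (hat (letters pre) l (X ʳ++ z ∷ x ∷ t)) (X ʳ++ z ∷ x ∷ t))
            (replicate-shift (length X) (0 ∷ b)))
    (weave-hat-pull X pre z (0 ∷ b) (x ∷ t) (0 ∷ cs) ss w inner))
  (cong (λ i → drop i (z ∷ X ++ pre) ʳ++ 0 ∷ (take i (z ∷ X ++ pre) ʳ++ x ∷ weave cs t)) (sym sinks))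
  where
  sinks : (if true ∧ (z <ᵇ suc (letters (X ++ pre))) then suc (sink z (X ++ pre)) else 0) ≡ suc (sink z (X ++ pre))
  sinks rewrite <ᵇ-true (s≤s (proj₂ (sub-parts {letters (X ++ pre)} {z} s))) = refl
  inner : hat (letters (X ++ pre)) (0 ∷ 0 ∷ b) (z ∷ x ∷ t) ≡ 1 ∷ 0 ∷ cs
  inner rewrite s | l | sym (letters-sub _ z (X ++ pre) s) | e = refl
... | false = trans
  (cong (λ l → pre ʳ++ weave (hat (letters pre) l (X ʳ++ z ∷ x ∷ t)) (X ʳ++ z ∷ x ∷ t))
            (replicate-shift (length X) (0 ∷ b)))
  (weave-hat-ʳ++ X pre (0 ∷ b) (z ∷ x ∷ t) (1 ∷ cs) ss inner)
  where
  inner : hat (letters (X ++ pre)) (0 ∷ 0 ∷ b) (z ∷ x ∷ t) ≡ 0 ∷ 1 ∷ cs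
  inner rewrite s | l | sym (letters-sub _ z (X ++ pre) s) | e = refl

step-wall : ∀ pre u → Wall pre → step pre u ≡ push 0 pre u
step-wall pre u w rewrite w with subR (letters pre) u in s
... | true  = refl
... | false = sym (push-stay 0 pre u (climb-nonsub _ u s))

step-pull : ∀ x P u → sub (letters P) x ≡ true → subR (letters (x ∷ P)) u ≡ false →
  step (x ∷ P) u ≡ pull 0 (x ∷ P) u
step-pull x P u s n rewrite s | n = refl

step-pull′ : ∀ x P y u → sub (letters P) x ≡ true → sub (letters (x ∷ P)) y ≡ true → x < y →
  step (x ∷ P) (y ∷ u) ≡ pull 0 (x ∷ P) (y ∷ u)
step-pull′ x P y u s n x<y rewrite s | n | <ᵇ-false (<⇒≤ x<y) | <ᵇ-true x<y = refl

step-push : ∀ x P y u → sub (letters P) x ≡ true → sub (letters (x ∷ P)) y ≡ true → y < x →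
  step (x ∷ P) (y ∷ u) ≡ push 0 (x ∷ P) (y ∷ u)
step-push x P y u s n y<x rewrite s | n | <ᵇ-true y<x = refl

-- The zeros to the right have moved already, those in `pre` have not, and the slots in front of the
-- letters of `X` are empty. Directly behind a wall a zero can only climb, which is `weave-hat-suc`.
-- Behind a letter `x` of the block it climbs if a smaller subexcedent letter follows; otherwise the
-- exchange at `x` takes it across `x`, and `weave-hat-pull` takes it on.
step-hat : ∀ X pre p a v → length a ≡ length v → All (0 <_) v → Linked _≢_ (take 1 X ++ v) →
  Subs X pre → Wall pre →
  step (X ++ pre) (weave (hat (letters (X ++ pre)) (p ∷ a) v) v) ≡
  pre ʳ++ weave (hat (letters pre) (replicate (length X) 0 ++ suc p ∷ a) (X ʳ++ v)) (X ʳ++ v)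
step-hat [] pre p a v len pos adj [] w =
  trans (step-wall pre _ w) (sym (weave-hat-suc pre p a v len pos adj))
step-hat (x ∷ X) pre p a v len pos adj (s ∷ ss) w
  = main (hat-cons (letters (x ∷ P)) p a v)
  where
  P = X ++ pre
  L≡ : letters (x ∷ P) ≡ suc (letters P)
  L≡ = letters-sub _ x P s
  Goal : List ℕ → Set
  Goal u = step (x ∷ P) u ≡
    pre ʳ++ weave (hat (letters pre) (replicate (suc (length X)) 0 ++ suc p ∷ a) (X ʳ++ x ∷ v)) (X ʳ++ x ∷ v)
  pulled : ∀ h c → hat (letters P) (0 ∷ suc p ∷ a) (x ∷ v) ≡ 1 ∷ h ∷ c →
    step (x ∷ P) (weave (h ∷ c) v) ≡ pull 0 (x ∷ P) (weave (h ∷ c) v) → Goal (weave (h ∷ c) v)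
  pulled h c e st = trans st (trans
    (pull-pass 0 x P _ (<ᵇ-true (proj₁ (sub-parts {letters P} {x} s)))
      (<ᵇ-true (s≤s (proj₂ (sub-parts {letters P} {x} s)))))
    (sym (trans
      (cong (λ l → pre ʳ++ weave (hat (letters pre) l (X ʳ++ x ∷ v)) (X ʳ++ x ∷ v))
        (replicate-shift (length X) (suc p ∷ a)))
      (weave-hat-pull X pre x (suc p ∷ a) v (h ∷ c) ss w e))))
  pulled-asc : ∀ h c → hat (letters (x ∷ P)) (p ∷ a) v ≡ h ∷ c → drops x v ≡ false →
    hat (letters P) (0 ∷ suc p ∷ a) (x ∷ v) ≡ 1 ∷ h ∷ c
  pulled-asc h c e d = trans (hat-asc (letters P) 0 (suc p) a x v s d)
    (cong (1 ∷_) (trans (cong (λ L → hat L (p ∷ a) v) (sym L≡)) e))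
  pulled-nonsub : ∀ h c → hat (letters (x ∷ P)) (p ∷ a) v ≡ h ∷ c →
    subR (letters (x ∷ P)) (weave (h ∷ c) v) ≡ false →
    hat (letters P) (0 ∷ suc p ∷ a) (x ∷ v) ≡ 1 ∷ h ∷ c
  pulled-nonsub h c e n = by-drops (drops x v) refl
    where
    by-drops : ∀ b → drops x v ≡ b → hat (letters P) (0 ∷ suc p ∷ a) (x ∷ v) ≡ 1 ∷ h ∷ c
    by-drops false d = pulled-asc h c e d
    -- At a descent the right part is treated first. The additional zero must still head it
    -- afterwards, so that `swapHead 0` can take exactly one zero across `x`.
    by-drops true  d = trans (hat-desc (letters P) 0 (suc p) a x v s d)
      (cong (swapHead 0) (trans (cong (λ L → hat L (suc p ∷ a) v) (sym L≡))
        (hat-suc-nonsub (letters (x ∷ P)) p a v h c e n len)))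
  letter : ∀ y v' c → v ≡ y ∷ v' → hat (letters (x ∷ P)) (p ∷ a) v ≡ 0 ∷ c → x ≢ y →
    sub (letters (x ∷ P)) y ≡ true → Goal (y ∷ weave c v')
  letter y v' c refl e x≢y n with <-cmp x y
  ... | tri< x<y _ _ = pulled 0 c (pulled-asc 0 c e (<ᵇ-false (<⇒≤ x<y))) (step-pull′ x P y _ s n x<y)
  ... | tri≈ _ x≡y _ = ⊥-elim (x≢y x≡y)
  ... | tri> _ _ y<x = trans (step-push x P y _ s n y<x) (trans
    (trans (cong (push 0 (x ∷ P)) (cong (λ l → weave l v) (sym e)))
      (sym (weave-hat-suc (x ∷ P) p a v len pos (Linked.tail adj))))
    (sym (trans
      (cong (λ l → pre ʳ++ weave (hat (letters pre) l (X ʳ++ x ∷ v)) (X ʳ++ x ∷ v))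
        (replicate-shift (length X) (suc p ∷ a)))
      (pushed (hat-suc-sub (letters (x ∷ P)) p a y v' c e n len)))))
    where
    pushed : (∃ λ t → hat (letters (x ∷ P)) (suc p ∷ a) v ≡ 0 ∷ t) →
      pre ʳ++ weave (hat (letters pre) (replicate (length X) 0 ++ 0 ∷ suc p ∷ a) (X ʳ++ x ∷ v)) (X ʳ++ x ∷ v) ≡
      (x ∷ P) ʳ++ weave (hat (letters (x ∷ P)) (suc p ∷ a) v) v
    pushed (t , e') = trans
      (weave-hat-ʳ++ X pre (suc p ∷ a) (x ∷ v) (0 ∷ t) ss
        (trans (hat-desc (letters P) 0 (suc p) a x v s (<ᵇ-true y<x))
          (cong (swapHead 0) (trans (cong (λ L → hat L (suc p ∷ a) v) (sym L≡)) e'))))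
      (cong (λ l → (x ∷ P) ʳ++ weave l v) (sym e'))
  dispatch : ∀ h c → hat (letters (x ∷ P)) (p ∷ a) v ≡ h ∷ c →
    ∀ b → subR (letters (x ∷ P)) (weave (h ∷ c) v) ≡ b → Goal (weave (h ∷ c) v)
  dispatch h c e false n = pulled h c (pulled-nonsub h c e n) (step-pull x P _ s n)
  dispatch zero c e true n = go v refl adj n
    where
    go : ∀ v' → v ≡ v' → Linked _≢_ (x ∷ v') → subR (letters (x ∷ P)) (weave (0 ∷ c) v') ≡ true → Goal (weave (0 ∷ c) v')
    go (y ∷ v') v≡ (x≢y ∷ _) n = letter y v' c v≡ e x≢y n
  main : (∃₂ λ h c → hat (letters (x ∷ P)) (p ∷ a) v ≡ h ∷ c) → Goal (weave (hat (letters (x ∷ P)) (p ∷ a) v) v)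
  main (h , c , e) = subst (λ l → Goal (weave l v)) (sym e) (dispatch h c e _ refl)

zeros-subs : ∀ {X pre} → Subs X pre → zeros (X ++ pre) ≡ zeros pre
zeros-subs []                     = refl
zeros-subs (_∷_ {x = suc x} s ss) = zeros-subs ss

untake : ∀ (X : List ℕ) {v} → Linked _≢_ (take 1 X ++ v) → Linked _≢_ v
untake []      adj = adj
untake (x ∷ X) adj = Linked.tail adj

-- `foldr` applies the highest index first, so reading from the left postpones the zero just read
-- until all later ones have moved. Meanwhile that zero is a wall for them, and the block `X` starts
-- anew; a letter that is not subexcedent likewise closes the block and becomes the next wall. A
-- subexcedent letter joins `X`.
foldr-φ-hat : ∀ X pre p a v → length a ≡ length v → All (0 <_) v → Linked _≢_ (take 1 X ++ v) →
  Subs X pre → Wall pre →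
  foldr φ ((X ++ pre) ʳ++ weave (p ∷ a) v) (seq (suc (zeros pre)) (p + sum a)) ≡
  pre ʳ++ weave (hat (letters pre) (replicate (length X) 0 ++ p ∷ a) (X ʳ++ v)) (X ʳ++ v)
foldr-φ-hat X pre (suc p) a v len pos adj ss w = begin
  φ (suc (zeros pre)) (foldr φ ((0 ∷ X ++ pre) ʳ++ weave (p ∷ a) v) (seq (suc (suc (zeros pre))) (p + sum a)))
    ≡⟨ cong (λ z → φ (suc z) (foldr φ ((0 ∷ X ++ pre) ʳ++ weave (p ∷ a) v) (seq (suc (suc z)) (p + sum a))))
         (sym (zeros-subs ss)) ⟩
  φ (suc (zeros (X ++ pre))) (foldr φ ((0 ∷ X ++ pre) ʳ++ weave (p ∷ a) v) (seq (suc (suc (zeros (X ++ pre)))) (p + sum a)))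
    ≡⟨ cong (φ (suc (zeros (X ++ pre)))) (foldr-φ-hat [] (0 ∷ X ++ pre) p a v len pos (untake X adj) [] refl) ⟩
  φ (suc (zeros (X ++ pre))) ((X ++ pre) ʳ++ 0 ∷ weave (hat (letters (X ++ pre)) (p ∷ a) v) v)
    ≡⟨ φ-step (X ++ pre) _ ⟩
  step (X ++ pre) (weave (hat (letters (X ++ pre)) (p ∷ a) v) v)
    ≡⟨ step-hat X pre p a v len pos adj ss w ⟩
  _ ∎
  where
  open ≡-Reasoning
foldr-φ-hat X pre zero [] [] len pos adj ss w =
  sym (trans (weave-hat-ʳ++ X pre [] [] [] ss refl) refl)
foldr-φ-hat X pre zero (q ∷ a) (x ∷ v) len (0<x ∷ pos) adj ss w with sub (letters (X ++ pre)) x in s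
... | true = trans
  (foldr-φ-hat (x ∷ X) pre q a v (suc-injective len) pos (untake X adj) (s ∷ ss) w)
  (cong (λ l → pre ʳ++ weave (hat (letters pre) l (X ʳ++ x ∷ v)) (X ʳ++ x ∷ v)) (replicate-shift (length X) (q ∷ a)))
... | false = trans
  (cong (λ z → foldr φ ((x ∷ X ++ pre) ʳ++ weave (q ∷ a) v) (seq (suc z) (q + sum a))) (sym zeros≡))
  (trans (foldr-φ-hat [] (x ∷ X ++ pre) q a v (suc-injective len) pos (Linked.tail (untake X adj)) [] s)
  (sym (weave-hat-ʳ++ X pre (q ∷ a) (x ∷ v) (hat (letters (x ∷ X ++ pre)) (q ∷ a) v) ss
    (trans (hat-exc (letters (X ++ pre)) 0 q a x v s)
      (cong (λ L → 0 ∷ hat L (q ∷ a) v) (sym (nz-letters x (X ++ pre) 0<x)))))))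
  where
  zeros≡ : zeros (x ∷ X ++ pre) ≡ zeros pre
  zeros≡ = trans (nz-zeros x (X ++ pre) 0<x) (zeros-subs ss)

zeros-weave : ∀ p a v → length a ≡ length v → All (0 <_) v → zeros (weave (p ∷ a) v) ≡ p + sum a
zeros-weave (suc p) a v len pos = cong suc (zeros-weave p a v len pos)
zeros-weave zero [] [] len pos = refl
zeros-weave zero (q ∷ a) (suc x ∷ v) len (_ ∷ pos) = zeros-weave q a v (suc-injective len) pos

length-weave : ∀ p a v → length a ≡ length v → length (weave (p ∷ a) v) ≡ (p + sum a) + length v
length-weave (suc p) a v len = cong suc (length-weave p a v len)
length-weave zero [] [] len = refl
length-weave zero (q ∷ a) (x ∷ v) len = trans (cong suc (length-weave q a v (suc-injective len))) (sym (+-suc _ _))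

seq-++ : ∀ a m n → seq a (m + n) ≡ seq a m ++ seq (a + m) n
seq-++ a zero    n = cong (λ b → seq b n) (sym (+-identityʳ a))
seq-++ a (suc m) n = cong (a ∷_) (trans (seq-++ (suc a) m n) (cong (λ b → seq (suc a) m ++ seq b n) (sym (+-suc a m))))

foldr-φ-out : ∀ k n w → zeros w < k → foldr φ w (seq k n) ≡ w
foldr-φ-out k zero    w z<k = refl
foldr-φ-out k (suc n) w z<k = trans (cong (φ k) (foldr-φ-out (suc k) n w (m<n⇒m<1+n z<k))) (φ-out k w z<k)

-- Indices above the number of zeros act as the identity, which cuts the fold over all positions
-- down to one over the zeros.
Φ-weave : ∀ p a v → length a ≡ length v → All (0 <_) v → Linked _≢_ v →
  Φ (weave (p ∷ a) v) ≡ weave (hat 0 (p ∷ a) v) v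
Φ-weave p a v len pos adj
  rewrite range≡seq 1 (length (weave (p ∷ a) v)) | length-weave p a v len
        | seq-++ 1 (p + sum a) (length v)
        | foldr-++ φ (weave (p ∷ a) v) (seq 1 (p + sum a)) (seq (suc (p + sum a)) (length v))
        | foldr-φ-out (suc (p + sum a)) (length v) (weave (p ∷ a) v) (s≤s (≤-reflexive (zeros-weave p a v len pos)))
  = foldr-φ-hat [] [] p a v len pos adj [] refl

-- The letters are kept by `Φ`; words as pairs of letters and contents.

strip : List ℕ → List ℕ
strip = filterᵇ nz

strip-++ : ∀ xs ys → strip (xs ++ ys) ≡ strip xs ++ strip ys
strip-++ []           ys = refl
strip-++ (zero ∷ xs)  ys = strip-++ xs ys
strip-++ (suc x ∷ xs) ys = cong (suc x ∷_) (strip-++ xs ys)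

strip-ʳ++ : ∀ pre u → strip (pre ʳ++ u) ≡ strip pre ʳ++ strip u
strip-ʳ++ []            u = refl
strip-ʳ++ (zero ∷ pre)  u = strip-ʳ++ pre (0 ∷ u)
strip-ʳ++ (suc x ∷ pre) u = strip-ʳ++ pre (suc x ∷ u)

strip-push : ∀ pre u → strip (push 0 pre u) ≡ strip (pre ʳ++ 0 ∷ u)
strip-push pre u = trans (strip-ʳ++ pre _) (trans
  (cong (strip pre ʳ++_) (trans (strip-++ (take n u) _)
    (trans (sym (strip-++ (take n u) (drop n u))) (cong strip (take++drop≡id n u)))))
  (sym (strip-ʳ++ pre (0 ∷ u))))
  where
  n = climb 0 (letters pre) u

strip-pull : ∀ pre u → strip (pull 0 pre u) ≡ strip (pre ʳ++ 0 ∷ u)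
strip-pull pre u = trans (strip-ʳ++ (drop n pre) _) (trans
  (sym (strip-ʳ++ (drop n pre) (take n pre ʳ++ u)))
  (trans (cong strip (sym (++-ʳ++ (take n pre)))) (trans (cong (λ l → strip (l ʳ++ u)) (take++drop≡id n pre))
    (trans (strip-ʳ++ pre u) (sym (strip-ʳ++ pre (0 ∷ u)))))))
  where
  n = sink 0 pre

strip-step : ∀ pre u → strip (step pre u) ≡ strip (pre ʳ++ 0 ∷ u)
strip-step pre u
  with (not (subL pre) ∧ subR (letters pre) u) ∨ (subL pre ∧ subR (letters pre) u ∧ (hd u <ᵇ hd pre))
     | (subL pre ∧ not (subR (letters pre) u)) ∨ (subL pre ∧ subR (letters pre) u ∧ (hd pre <ᵇ hd u))
... | true  | _     = strip-push pre u
... | false | true  = strip-pull pre u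
... | false | false = refl

split-zero : ∀ l pre u → zeros pre ≤ l → l < zeros pre + zeros u →
  ∃₂ λ pre' u' → pre ʳ++ u ≡ pre' ʳ++ 0 ∷ u' × zeros pre' ≡ l
split-zero l pre [] z≤l l<z = ⊥-elim (<⇒≱ l<z (subst (_≤ l) (sym (+-identityʳ _)) z≤l))
split-zero l pre (suc x ∷ u) z≤l l<z = split-zero l (suc x ∷ pre) u z≤l l<z
split-zero l pre (zero ∷ u) z≤l l<z with zeros pre ≟ l
... | yes z≡l = pre , u , refl , z≡l
... | no  z≢l = split-zero l (0 ∷ pre) u (≤∧≢⇒< z≤l z≢l) (subst (l <_) (+-suc _ _) l<z)

strip-φ : ∀ l w → strip (φ (suc l) w) ≡ strip w
strip-φ l w with zeros w ≤? l
... | yes z≤l = cong strip (φ-out (suc l) w (s≤s z≤l))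
... | no  z≰l with split-zero l [] w z≤n (≰⇒> z≰l)
...   | pre , u , refl , refl = trans (cong strip (φ-step pre u)) (strip-step pre u)

strip-foldr : ∀ k n w → strip (foldr φ w (seq (suc k) n)) ≡ strip w
strip-foldr k zero    w = refl
strip-foldr k (suc n) w = trans (strip-φ k (foldr φ w (seq (suc (suc k)) n))) (strip-foldr (suc k) n w)

-- This identifies the letters of a word of which only the image under `Φ` is known.
strip-Φ : ∀ w → strip (Φ w) ≡ strip w
strip-Φ w = trans (cong (strip ∘ foldr φ w) (range≡seq 1 (length w))) (strip-foldr 0 (length w) w)

strip-weave : ∀ p a v → length a ≡ length v → All (0 <_) v → strip (weave (p ∷ a) v) ≡ v
strip-weave (suc p) a v len pos = strip-weave p a v len pos
strip-weave zero [] [] len pos = refl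
strip-weave zero (q ∷ a) (suc x ∷ v) len (_ ∷ pos) = cong (suc x ∷_) (strip-weave q a v (suc-injective len) pos)

unweave : ∀ w → ∃₂ λ p a → length a ≡ length (strip w) × w ≡ weave (p ∷ a) (strip w)
unweave []          = 0 , [] , refl , refl
unweave (zero ∷ w)  with unweave w
... | p , a , len , e = suc p , a , len , cong (0 ∷_) e
unweave (suc x ∷ w) with unweave w
... | p , a , len , e = 0 , p ∷ a , cong suc len , cong (suc x ∷_) e

weave-injective : ∀ p a q b v → length a ≡ length v → length b ≡ length v → All (0 <_) v →
  weave (p ∷ a) v ≡ weave (q ∷ b) v → p ∷ a ≡ q ∷ b
weave-injective (suc p) a (suc q) b v la lb pos e
  with weave-injective p a q b v la lb pos (∷-injectiveʳ e)
... | refl = refl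
weave-injective zero [] zero [] [] la lb pos e = refl
weave-injective zero (p ∷ a) zero (q ∷ b) (x ∷ v) la lb (_ ∷ pos) e =
  cong (0 ∷_) (weave-injective p a q b v (suc-injective la) (suc-injective lb) pos (∷-injectiveʳ e))
weave-injective (suc p) a zero (q ∷ b) (suc x ∷ v) la lb pos ()
weave-injective (suc p) a zero (q ∷ b) (zero ∷ v) la lb (() ∷ _) e
weave-injective zero (p ∷ a) (suc q) b (zero ∷ v) la lb (() ∷ _) e
weave-injective zero (p ∷ a) (suc q) b (suc x ∷ v) la lb pos ()
weave-injective (suc p) a zero b [] la lb pos ()

-- Coloured slots

-- On `q ∷ c` with `c` of length s, the last entry has index s, so this puts the slot s into the
-- multiset.
bumpLast : List ℕ → List ℕ
bumpLast []          = []
bumpLast (x ∷ [])    = suc x ∷ []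
bumpLast (x ∷ y ∷ c) = x ∷ bumpLast (y ∷ c)

-- Read a slot of content p; the slot is coloured true if descending (for 𝐅) or green (for Ψ).
advance : Bool → ℕ → List ℕ → List ℕ
advance true  p       c = p ∷ c
advance false zero    c = c ∷ʳ 0
advance false (suc q) c = bumpLast (q ∷ c)

run : List ℕ → List Bool → List ℕ → List ℕ
run c (k ∷ ks) (p ∷ a) = run (advance k p c) ks a
run c _        _       = c

-- The first colour only conses. The second appends an entry, or conses and raises the last entry.
-- The two ends do not interfere, and `sw₁` and `sw₂` are chosen so that the same contents are
-- consed in the same order.
advance-swap : ∀ p q c →
  advance false q (advance true p c) ≡ advance true (sw₂ p q) (advance false (sw₁ p q) c)
advance-swap p zero    c = refl
advance-swap p (suc q) c = refl

descents : List ℕ → List Bool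
descents []      = []
descents (y ∷ v) = drops y v ∷ descents v

-- The colour of the slot behind `y`, where `r` letters precede `y`. It avoids `des` of the whole
-- word, so that `run-hat` can follow it letter by letter; `green-des` derives it from the descents.
green : ℕ → ℕ → List ℕ → Bool
green r y v =
  if sub r y then (if subR (suc r) v then drops y v else true)
  else (if subR (suc r) v then false else drops y v)

greens : ℕ → List ℕ → List Bool
greens r []      = []
greens r (y ∷ v) = green r y v ∷ greens (suc r) v

sub-≤ : ∀ {r y} → 0 < y → y ≤ r → sub r y ≡ true
sub-≤ {r} {suc y} _ y≤r = <ᵇ-true (s≤s y≤r)

nonsub-≥ : ∀ {r y} → 0 < y → sub r y ≡ false → r < y
nonsub-≥ {r} {suc y} _ e = false-≥ e

if-same : ∀ b {c} → (b ≡ true → c ≡ true) → (if b then true else c) ≡ c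
if-same true  f = sym (f refl)
if-same false f = refl

green-desc : ∀ {r y v} → sub r y ≡ true → drops y v ≡ true → green r y v ≡ true
green-desc {r} {y} {v} s d rewrite s with subR (suc r) v
... | true  = d
... | false = refl

green-asc : ∀ {r y v} → sub r y ≡ true → drops y v ≡ false → green r y v ≡ (if subR (suc r) v then false else true)
green-asc {r} {y} {v} s d rewrite s with subR (suc r) v
... | true  = d
... | false = refl

green-exc : ∀ {r y v} → sub r y ≡ false → green r y v ≡ (if subR (suc r) v then false else drops y v)
green-exc s rewrite s = refl

if-true : ∀ (b : Bool) → (if b then true else true) ≡ true
if-true true  = refl
if-true false = refl

run-swapHead : ∀ c p ks H → ∃₂ (λ h t → H ≡ h ∷ t) →
  run (advance true p c) (false ∷ ks) H ≡ run c (false ∷ true ∷ ks) (swapHead p H)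
run-swapHead c p ks _ (h , t , refl) = cong (λ d → run d ks t) (advance-swap p h c)

-- If a block starts with `v`, the slot before it is of the first colour on the left and of the
-- second on the right; otherwise its colour `k` is the same on both sides. After a subexcedent
-- letter the induction uses `k = true`: the first colour has been carried past that letter, and it
-- remains there if the block ends.
run-hat : ∀ k r c p a v → length a ≡ length v → All (0 <_) v →
  All (λ px → proj₁ px ≢ proj₂ px) (indexed (suc r) v) →
  run c ((if subR r v then true else k) ∷ descents v) (p ∷ a) ≡
  run c ((if subR r v then false else k) ∷ greens r v) (hat r (p ∷ a) v)
run-hat k r c p [] [] len pos der = refl
run-hat k r c p (q ∷ a) (y ∷ v) len (0<y ∷ pos) (r≢y ∷ der) = by-sub (sub r y) refl
  where
  Claim : Bool → Set
  Claim s = run c ((if s then true else k) ∷ descents (y ∷ v)) (p ∷ q ∷ a) ≡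
    run c ((if s then false else k) ∷ greens r (y ∷ v)) (hat r (p ∷ q ∷ a) (y ∷ v))
  IH : ∀ k c p → run c ((if subR (suc r) v then true else k) ∷ descents v) (p ∷ a) ≡
    run c ((if subR (suc r) v then false else k) ∷ greens (suc r) v) (hat (suc r) (p ∷ a) v)
  IH k c p = run-hat k (suc r) c p a v (suc-injective len) pos der
  -- As `y` is neither subexcedent nor fixed, it exceeds its rank `suc r`, while a subexcedent
  -- successor is at most `suc r`. Hence the slot before a block is a descent.
  below-exc : sub r y ≡ false → ∀ v → subR (suc r) v ≡ true → drops y v ≡ true
  below-exc s (z ∷ v) sz =
    <ᵇ-true (≤-<-trans (proj₂ (sub-parts {suc r} {z} sz)) (≤∧≢⇒< (nonsub-≥ 0<y s) r≢y))
  -- A smaller letter after a subexcedent one is itself subexcedent, so a descent behind a letter of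
  -- the block lies inside the block.
  below-sub : sub r y ≡ true → ∀ v → All (0 <_) v → drops y v ≡ true → subR (suc r) v ≡ true
  below-sub s (z ∷ v) (0<z ∷ _) d =
    sub-≤ 0<z (≤-trans (<⇒≤ (true-< d)) (m≤n⇒m≤1+n (proj₂ (sub-parts {r} {y} s))))
  open ≡-Reasoning
  by-drops : sub r y ≡ true → ∀ d → drops y v ≡ d → Claim true
  by-drops s true d = begin
    run (advance true p c) (drops y v ∷ descents v) (q ∷ a)
      ≡⟨ cong (λ b → run (advance true p c) (b ∷ descents v) (q ∷ a)) (trans d (sym (if-true (subR (suc r) v)))) ⟩
    run (advance true p c) ((if subR (suc r) v then true else true) ∷ descents v) (q ∷ a)
      ≡⟨ IH true (advance true p c) q ⟩
    run (advance true p c) ((if subR (suc r) v then false else true) ∷ greens (suc r) v) (hat (suc r) (q ∷ a) v)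
      ≡⟨ cong (λ b → run (advance true p c) ((if b then false else true) ∷ greens (suc r) v) (hat (suc r) (q ∷ a) v))
           (below-sub s v pos d) ⟩
    run (advance true p c) (false ∷ greens (suc r) v) (hat (suc r) (q ∷ a) v)
      ≡⟨ run-swapHead c p (greens (suc r) v) _ (hat-cons (suc r) q a v) ⟩
    run c (false ∷ true ∷ greens (suc r) v) (swapHead p (hat (suc r) (q ∷ a) v))
      ≡⟨ cong₂ (λ b H → run c (false ∷ b ∷ greens (suc r) v) H)
           (sym (green-desc {r} {y} {v} s d)) (sym (hat-desc r p q a y v s d)) ⟩
    run c (false ∷ greens r (y ∷ v)) (hat r (p ∷ q ∷ a) (y ∷ v)) ∎
  by-drops s false d = begin
    run (advance true p c) (drops y v ∷ descents v) (q ∷ a)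
      ≡⟨ cong (λ b → run (advance true p c) (b ∷ descents v) (q ∷ a)) d ⟩
    run (advance false q (advance true p c)) (descents v) a
      ≡⟨ cong (λ c → run c (descents v) a) (advance-swap p q c) ⟩
    run (advance false (sw₁ p q) c) (true ∷ descents v) (sw₂ p q ∷ a)
      ≡⟨ cong (λ b → run (advance false (sw₁ p q) c) (b ∷ descents v) (sw₂ p q ∷ a)) (sym (if-true (subR (suc r) v))) ⟩
    run (advance false (sw₁ p q) c) ((if subR (suc r) v then true else true) ∷ descents v) (sw₂ p q ∷ a)
      ≡⟨ IH true (advance false (sw₁ p q) c) (sw₂ p q) ⟩
    run c (false ∷ (if subR (suc r) v then false else true) ∷ greens (suc r) v) (sw₁ p q ∷ hat (suc r) (sw₂ p q ∷ a) v)
      ≡⟨ cong₂ (λ b H → run c (false ∷ b ∷ greens (suc r) v) H)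
           (sym (green-asc {r} {y} {v} s d)) (sym (hat-asc r p q a y v s d)) ⟩
    run c (false ∷ greens r (y ∷ v)) (hat r (p ∷ q ∷ a) (y ∷ v)) ∎
  by-sub : ∀ s → sub r y ≡ s → Claim s
  by-sub true  s = by-drops s (drops y v) refl
  by-sub false s = begin
    run (advance k p c) (drops y v ∷ descents v) (q ∷ a)
      ≡⟨ cong (λ b → run (advance k p c) (b ∷ descents v) (q ∷ a)) (sym (if-same (subR (suc r) v) (below-exc s v))) ⟩
    run (advance k p c) ((if subR (suc r) v then true else drops y v) ∷ descents v) (q ∷ a)
      ≡⟨ IH (drops y v) (advance k p c) q ⟩
    run c (k ∷ (if subR (suc r) v then false else drops y v) ∷ greens (suc r) v) (p ∷ hat (suc r) (q ∷ a) v)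
      ≡⟨ cong₂ (λ b H → run c (k ∷ b ∷ greens (suc r) v) H)
           (sym (green-exc {r} {y} {v} s)) (sym (hat-exc r p q a y v s)) ⟩
    run c (k ∷ greens r (y ∷ v)) (hat r (p ∷ q ∷ a) (y ∷ v)) ∎

-- 𝐅 on slot contents

weave-[] : ∀ p → weave (p ∷ []) [] ≡ replicate p 0
weave-[] zero    = refl
weave-[] (suc p) = cong (0 ∷_) (weave-[] p)

weave-bumpLast : ∀ c v → length c ≡ suc (length v) → weave (bumpLast c) v ≡ weave c v ++ [ 0 ]
weave-bumpLast (zero ∷ [])      []      len = refl
weave-bumpLast (suc p ∷ [])     []      len = cong (0 ∷_) (weave-bumpLast (p ∷ []) [] len)
weave-bumpLast (zero ∷ q ∷ c)   (x ∷ v) len = cong (x ∷_) (weave-bumpLast (q ∷ c) v (suc-injective len))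
weave-bumpLast (suc p ∷ q ∷ c)  (x ∷ v) len = cong (0 ∷_) (weave-bumpLast (p ∷ q ∷ c) (x ∷ v) len)

weave-∷ʳ : ∀ c v x → length c ≡ suc (length v) → weave (c ∷ʳ 0) (v ∷ʳ x) ≡ weave c v ++ [ x ]
weave-∷ʳ (zero ∷ [])      []      x len = refl
weave-∷ʳ (suc p ∷ [])     []      x len = cong (0 ∷_) (weave-∷ʳ (p ∷ []) [] x len)
weave-∷ʳ (zero ∷ q ∷ c)   (y ∷ v) x len = cong (y ∷_) (weave-∷ʳ (q ∷ c) v x (suc-injective len))
weave-∷ʳ (suc p ∷ q ∷ c)  (y ∷ v) x len = cong (0 ∷_) (weave-∷ʳ (p ∷ q ∷ c) (y ∷ v) x len)

rearr-weave-∷ : ∀ z q c x v → rearr z (weave (q ∷ c) (suc x ∷ v)) ≡ suc x ∷ replicate (z + q) 0 ++ posRun (weave c v)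
rearr-weave-∷ z zero    c x v = cong (λ k → suc x ∷ replicate k 0 ++ posRun (weave c v)) (sym (+-identityʳ z))
rearr-weave-∷ z (suc q) c x v = trans (rearr-weave-∷ (suc z) q c x v)
  (cong (λ k → suc x ∷ replicate k 0 ++ posRun (weave c v)) (sym (+-suc z q)))

replicate-weave₀ : ∀ z c v → replicate z 0 ++ weave (0 ∷ c) v ≡ weave (z ∷ c) v
replicate-weave₀ zero    c v = refl
replicate-weave₀ (suc z) c v = cong (0 ∷_) (replicate-weave₀ z c v)

posRun-weave : ∀ c v → length c ≡ length v → All (0 <_) v → posRun (weave (c ∷ʳ 0) v) ≡ weave (0 ∷ c) v
posRun-weave []          []          len pos       = refl
posRun-weave (zero ∷ c)  (suc x ∷ v) len (_ ∷ pos) = cong (suc x ∷_) (posRun-weave c v (suc-injective len) pos)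
posRun-weave (suc q ∷ c) (suc x ∷ v) len (_ ∷ pos) = trans (rearr-weave-∷ 1 q (c ∷ʳ 0) x v)
  (cong (suc x ∷_) (trans (cong (replicate (suc q) 0 ++_) (posRun-weave c v (suc-injective len) pos))
    (replicate-weave₀ (suc q) c v)))

-- Every letter changes places with the zeros directly before it, so all contents move one slot to
-- the right; for the letters of the words vᵢ there is nothing to move.
rearr-weave : ∀ c v → length c ≡ length v → All (0 <_) v → rearr 0 (weave (c ∷ʳ 0) v) ≡ weave (0 ∷ c) v
rearr-weave []      []          len pos       = refl
rearr-weave (q ∷ c) (suc x ∷ v) len (_ ∷ pos) = trans (rearr-weave-∷ 0 q (c ∷ʳ 0) x v)
  (cong (suc x ∷_) (trans (cong (replicate q 0 ++_) (posRun-weave c v (suc-injective len) pos))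
    (replicate-weave₀ q c v)))

dropLast-∷ʳ : ∀ w x → dropLast (w ++ [ x ]) ≡ w
dropLast-∷ʳ w x rewrite reverse-++ w [ x ] = reverse-involutive w

-- The recursion of `F`, on reversed words, where the last letter is the head.

Fr : List ℕ → List ℕ
Fr l = F (reverse l)

lastZeros : List ℕ → ℕ
lastZeros l = length (takeWhileᵇ (_≡ᵇ 0) l)

extend : ℕ → ℕ → ℕ → List ℕ → List ℕ
extend a b r u =
  if a ≤ᵇ b then u ++ [ b ]
  else (if 1 ≤ᵇ r then 0 ∷ dropLast u ++ [ b ] else rearr 0 u ++ [ b ])

Fr-flat : ∀ b l → dropWhileᵇ (_≡ᵇ 0) l ≡ [] → Fr (b ∷ l) ≡ reverse (b ∷ l)
Fr-flat b l e rewrite length-reverse (b ∷ l) | reverse-involutive (b ∷ l) | e = refl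

-- The fuel left after removing `b` is the length of the remaining word, so the recursive call is
-- again `F`.
Fr-extend : ∀ b l a l' → dropWhileᵇ (_≡ᵇ 0) l ≡ a ∷ l' → Fr (b ∷ l) ≡
  (if des (reverse (b ∷ l)) ≡ᵇ 0 then reverse (b ∷ l) else extend a b (lastZeros l) (Fr l))
Fr-extend b l a l' e rewrite length-reverse (b ∷ l) | reverse-involutive (b ∷ l) | length-reverse l | e = refl

des-∷ʳ : ∀ w x y → des (w ++ x ∷ y ∷ []) ≡ des (w ++ x ∷ []) + (if y <ᵇ x then 1 else 0)
des-∷ʳ []           x y = +-comm (if y <ᵇ x then 1 else 0) 0
des-∷ʳ (z ∷ [])     x y = trans (cong ((if x <ᵇ z then 1 else 0) +_) (des-∷ʳ [] x y)) (sym (+-assoc (if x <ᵇ z then 1 else 0) 0 _))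
des-∷ʳ (z ∷ z' ∷ w) x y = trans (cong ((if z' <ᵇ z then 1 else 0) +_) (des-∷ʳ (z' ∷ w) x y))
  (sym (+-assoc (if z' <ᵇ z then 1 else 0) _ _))

des-reverse : ∀ b x l → des (reverse (b ∷ x ∷ l)) ≡ des (reverse (x ∷ l)) + (if b <ᵇ x then 1 else 0)
des-reverse b x l = trans
  (cong des (trans (unfold-reverse b (x ∷ l)) (trans (cong (_++ [ b ]) (unfold-reverse x l)) (++-assoc (reverse l) _ _))))
  (trans (des-∷ʳ (reverse l) x b) (cong (λ w → des w + (if b <ᵇ x then 1 else 0)) (sym (unfold-reverse x l))))

≡ᵇ0 : ∀ {n} → (n ≡ᵇ 0) ≡ true → n ≡ 0
≡ᵇ0 {zero} _ = refl

des0-parts : ∀ b x l → des (reverse (b ∷ x ∷ l)) ≡ 0 → des (reverse (x ∷ l)) ≡ 0 × x ≤ b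
des0-parts b x l e with trans (sym (des-reverse b x l)) e
... | e' with b <ᵇ x in q
...   | false = m+n≡0⇒m≡0 _ e' , false-≥ q
...   | true  = ⊥-elim (1+n≢0 (m+n≡0⇒n≡0 (des (reverse (x ∷ l))) e'))

Fr-des0 : ∀ l → des (reverse l) ≡ 0 → Fr l ≡ reverse l
Fr-des0 []      e = refl
Fr-des0 (b ∷ l) e = by-last (dropWhileᵇ (_≡ᵇ 0) l) refl
  where
  by-last : ∀ d → dropWhileᵇ (_≡ᵇ 0) l ≡ d → Fr (b ∷ l) ≡ reverse (b ∷ l)
  by-last []       q = Fr-flat b l q
  by-last (a ∷ l') q = trans (Fr-extend b l a l' q)
    (cong (λ n → if n ≡ᵇ 0 then reverse (b ∷ l) else extend a b (lastZeros l) (Fr l)) e)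

-- Somewhere between a nonzero letter and the final zero the word falls to 0.
des0-no-zeros : ∀ l a l' → dropWhileᵇ (_≡ᵇ 0) l ≡ a ∷ l' → des (reverse (0 ∷ l)) ≢ 0
des0-no-zeros (suc x ∷ l) a l' q e = n≮0 (proj₂ (des0-parts 0 (suc x) l e))
des0-no-zeros (zero ∷ l)  a l' q e = des0-no-zeros l a l' q (proj₁ (des0-parts 0 0 l e))

ascending : ∀ b l a l' → dropWhileᵇ (_≡ᵇ 0) l ≡ a ∷ l' → des (reverse (b ∷ l)) ≡ 0 →
  reverse (b ∷ l) ≡ extend a b (lastZeros l) (Fr l)
ascending b (zero ∷ l)  a l' q e = ⊥-elim (des0-no-zeros l a l' q (proj₁ (des0-parts b 0 l e)))
ascending b (suc x ∷ l) a l' refl e with des0-parts b (suc x) l e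
... | e' , x≤b rewrite ≤ᵇ-true x≤b | Fr-des0 (suc x ∷ l) e' = unfold-reverse b (suc x ∷ l)

-- A word without descents falls under the rule a ≤ b, so the condition on des may be dropped.
Fr-∷ : ∀ b l a l' → dropWhileᵇ (_≡ᵇ 0) l ≡ a ∷ l' → Fr (b ∷ l) ≡ extend a b (lastZeros l) (Fr l)
Fr-∷ b l a l' q = trans (Fr-extend b l a l' q) (by-des _ refl)
  where
  by-des : ∀ z → (des (reverse (b ∷ l)) ≡ᵇ 0) ≡ z →
    (if z then reverse (b ∷ l) else extend a b (lastZeros l) (Fr l)) ≡ extend a b (lastZeros l) (Fr l)
  by-des true  e = ascending b l a l' q (≡ᵇ0 e)
  by-des false e = refl

-- The reverse of the word 0^q₁ x₁ ⋯ 0^qₛ xₛ, and the state reached after reading it.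
rword : List ℕ → List ℕ → List ℕ
rword (x ∷ vr) (q ∷ ar) = x ∷ replicate q 0 ++ rword vr ar
rword _        _        = []

-- The value for the empty word is the convention v₀ = ∞.
before : List ℕ → ℕ → Bool
before []      x = true
before (y ∷ _) x = x <ᵇ y

state : List ℕ → List ℕ → List ℕ
state (x ∷ vr) (q ∷ ar) = advance (before vr x) q (state vr ar)
state _        _        = []

bumpLast-length : ∀ c → length (bumpLast c) ≡ length c
bumpLast-length []          = refl
bumpLast-length (x ∷ [])    = refl
bumpLast-length (x ∷ y ∷ c) = cong suc (bumpLast-length (y ∷ c))

advance-length : ∀ k p c → length (advance k p c) ≡ suc (length c)
advance-length true  p       c = refl
advance-length false zero    c = trans (length-++ c) (+-comm _ 1)
advance-length false (suc q) c = bumpLast-length (q ∷ c)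

state-length : ∀ vr ar → length vr ≡ length ar → length (state vr ar) ≡ length vr
state-length []       []       len = refl
state-length (x ∷ vr) (q ∷ ar) len =
  trans (advance-length (before vr x) q _) (cong suc (state-length vr ar (suc-injective len)))

dropWhile-zeros : ∀ r l → dropWhileᵇ (_≡ᵇ 0) (replicate r 0 ++ l) ≡ dropWhileᵇ (_≡ᵇ 0) l
dropWhile-zeros zero    l = refl
dropWhile-zeros (suc r) l = dropWhile-zeros r l

dropWhile-pos : ∀ y l → 0 < y → dropWhileᵇ (_≡ᵇ 0) (y ∷ l) ≡ y ∷ l
dropWhile-pos (suc y) l _ = refl

lastZeros-zeros : ∀ r x l → 0 < x → lastZeros (replicate r 0 ++ x ∷ l) ≡ r
lastZeros-zeros zero    (suc x) l _ = refl
lastZeros-zeros (suc r) x       l p = cong suc (lastZeros-zeros r x l p)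

replicate-ʳ++ : ∀ p (s : ℕ) L → replicate p s ʳ++ L ≡ replicate p s ++ L
replicate-ʳ++ zero    s L = refl
replicate-ʳ++ (suc p) s L = trans (replicate-ʳ++ p s (s ∷ L)) (sym (replicate-shift p L))

reverse-zeros : ∀ r → reverse (replicate r 0) ≡ replicate r 0
reverse-zeros r = trans (replicate-ʳ++ r 0 []) (++-identityʳ _)

extend-asc : ∀ a b r u → a ≤ b → extend a b r u ≡ u ++ [ b ]
extend-asc a b r u a≤b rewrite ≤ᵇ-true a≤b = refl

-- As long as nothing follows `a`, its slot counts as an ascent. A letter `b < a` makes it a
-- descent, and both rules for this case replace `advance false r` by `advance true r`: for r = 0 by
-- shifting all contents one slot, for r > 0 by taking the last zero to the front.
extend-desc : ∀ a b r c v → b < a → length c ≡ length v → All (0 <_) v →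
  extend a b r (weave (advance false r c) v) ≡ weave (r ∷ c) v ++ [ b ]
extend-desc a b zero c v b<a len pos rewrite ≤ᵇ-false b<a | rearr-weave c v len pos = refl
extend-desc a b (suc q) c v b<a len pos
  rewrite ≤ᵇ-false b<a | weave-bumpLast (q ∷ c) v (cong suc len) | dropLast-∷ʳ (weave (q ∷ c) v) 0 = refl

All-ʳ++ : ∀ {P : ℕ → Set} xs {ys} → All P xs → All P ys → All P (xs ʳ++ ys)
All-ʳ++ []       []       q = q
All-ʳ++ (x ∷ xs) (p ∷ ps) q = All-ʳ++ xs ps (p ∷ q)

-- The slot of the `r` final zeros is provisionally an ascent. Each of these zeros is itself a last
-- letter smaller than `a`, so it too enters by `extend-desc`: becoming the new last entry of the
-- word, it turns `r ∷ S` into `bumpLast (r ∷ S)`.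
Fr-rword : ∀ vr ar r → length vr ≡ length ar → All (0 <_) vr →
  Fr (replicate r 0 ++ rword vr ar) ≡ weave (advance false r (state vr ar)) (reverse vr)
Fr-rword [] [] zero len pos = refl
Fr-rword [] [] (suc r) len pos = trans
  (Fr-flat 0 (replicate r 0 ++ []) (dropWhile-zeros r []))
  (trans (cong reverse (++-identityʳ (replicate (suc r) 0))) (trans (reverse-zeros (suc r)) (sym (weave-[] (suc r)))))
Fr-rword (x ∷ []) (q ∷ []) zero len (0<x ∷ pos) = trans
  (Fr-flat x (replicate q 0 ++ []) (dropWhile-zeros q []))
  (trans (cong (λ l → reverse (x ∷ l)) (++-identityʳ (replicate q 0)))
    (trans (unfold-reverse x (replicate q 0)) (trans (cong (_++ [ x ]) (trans (reverse-zeros q) (sym (weave-[] q))))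
      (sym (weave-∷ʳ (q ∷ []) [] x refl)))))
Fr-rword (x ∷ vr@(y ∷ vr')) (q ∷ ar@(q' ∷ ar')) zero len (0<x ∷ pos@(0<y ∷ _)) = begin
  Fr (x ∷ l)
    ≡⟨ Fr-∷ x l y _ (trans (dropWhile-zeros q _) (dropWhile-pos y _ 0<y)) ⟩
  extend y x (lastZeros l) (Fr l)
    ≡⟨ cong₂ (extend y x) (lastZeros-zeros q y _ 0<y) (Fr-rword vr ar q (suc-injective len) pos) ⟩
  extend y x q (weave (advance false q S) (reverse vr))
    ≡⟨ by-order (x <ᵇ y) refl ⟩
  weave (advance (x <ᵇ y) q S) (reverse vr) ++ [ x ]
    ≡⟨ sym (weave-∷ʳ (advance (x <ᵇ y) q S) (reverse vr) x
         (trans (advance-length (x <ᵇ y) q S) (cong suc lenS))) ⟩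
  weave (advance (x <ᵇ y) q S ∷ʳ 0) (reverse vr ∷ʳ x)
    ≡⟨ cong (weave (advance (x <ᵇ y) q S ∷ʳ 0)) (sym (unfold-reverse x vr)) ⟩
  weave (advance (x <ᵇ y) q S ∷ʳ 0) (reverse (x ∷ vr)) ∎
  where
  open ≡-Reasoning
  l = replicate q 0 ++ rword vr ar
  S = state vr ar
  lenS : length S ≡ length (reverse vr)
  lenS = trans (state-length vr ar (suc-injective len)) (sym (length-reverse vr))
  by-order : ∀ b → (x <ᵇ y) ≡ b →
    extend y x q (weave (advance false q S) (reverse vr)) ≡ weave (advance b q S) (reverse vr) ++ [ x ]
  by-order true  e = extend-desc y x q S (reverse vr) (true-< e) lenS (All-ʳ++ vr pos [])
  by-order false e = extend-asc y x q _ (false-≥ e)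
Fr-rword (x ∷ vr) (q ∷ ar) (suc r) len pos@(0<x ∷ _) = begin
  Fr (0 ∷ l)
    ≡⟨ Fr-∷ 0 l x _ (trans (dropWhile-zeros r _) (dropWhile-pos x _ 0<x)) ⟩
  extend x 0 (lastZeros l) (Fr l)
    ≡⟨ cong₂ (extend x 0) (lastZeros-zeros r x _ 0<x) (Fr-rword (x ∷ vr) (q ∷ ar) r len pos) ⟩
  extend x 0 r (weave (advance false r S) (reverse (x ∷ vr)))
    ≡⟨ extend-desc x 0 r S (reverse (x ∷ vr)) 0<x lenS (All-ʳ++ (x ∷ vr) pos []) ⟩
  weave (r ∷ S) (reverse (x ∷ vr)) ++ [ 0 ]
    ≡⟨ sym (weave-bumpLast (r ∷ S) (reverse (x ∷ vr)) (cong suc lenS)) ⟩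
  weave (bumpLast (r ∷ S)) (reverse (x ∷ vr)) ∎
  where
  open ≡-Reasoning
  l = replicate r 0 ++ rword (x ∷ vr) (q ∷ ar)
  S = state (x ∷ vr) (q ∷ ar)
  lenS : length S ≡ length (reverse (x ∷ vr))
  lenS = trans (state-length (x ∷ vr) (q ∷ ar) len) (sym (length-reverse (x ∷ vr)))

firstColour : List ℕ → List ℕ → Bool
firstColour []       v = true
firstColour (x ∷ vr) v = drops x v

F-weave-from : ∀ v p a vr ar → length a ≡ length v → All (0 <_) v → length vr ≡ length ar → All (0 <_) vr →
  F (rword vr ar ʳ++ weave (p ∷ a) v) ≡ weave (run (state vr ar) (firstColour vr v ∷ descents v) (p ∷ a)) (vr ʳ++ v)
F-weave-from [] p [] vr ar len pos len' pos' = begin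
  F (rword vr ar ʳ++ weave (p ∷ []) [])
    ≡⟨ cong F (trans (cong (rword vr ar ʳ++_) (trans (weave-[] p) (sym (reverse-zeros p))))
         (sym (++-ʳ++ (replicate p 0)))) ⟩
  Fr (replicate p 0 ++ rword vr ar)
    ≡⟨ Fr-rword vr ar p len' pos' ⟩
  weave (advance false p (state vr ar)) (reverse vr)
    ≡⟨ colour vr ar p ⟩
  weave (advance (firstColour vr []) p (state vr ar)) (reverse vr) ∎
  where
  open ≡-Reasoning
  -- A word without letters has one slot only, and both colours yield `p ∷ []`.
  colour : ∀ vr ar p → weave (advance false p (state vr ar)) (reverse vr) ≡
    weave (advance (firstColour vr []) p (state vr ar)) (reverse vr)
  colour []       ar zero    = refl
  colour []       ar (suc p) = refl
  colour (x ∷ vr) ar p       = refl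
F-weave-from (y ∷ v) p (q ∷ a) vr ar len (0<y ∷ pos) len' pos' = begin
  F (rword vr ar ʳ++ weave (p ∷ q ∷ a) (y ∷ v))
    ≡⟨ cong F (shift p) ⟩
  F (rword (y ∷ vr) (p ∷ ar) ʳ++ weave (q ∷ a) v)
    ≡⟨ F-weave-from v q a (y ∷ vr) (p ∷ ar) (suc-injective len) pos (cong suc len') (0<y ∷ pos') ⟩
  weave (run (advance (before vr y) p (state vr ar)) (drops y v ∷ descents v) (q ∷ a)) (vr ʳ++ y ∷ v)
    ≡⟨ cong (λ b → weave (run (advance b p (state vr ar)) (drops y v ∷ descents v) (q ∷ a)) (vr ʳ++ y ∷ v)) (colour vr) ⟩
  weave (run (state vr ar) (firstColour vr (y ∷ v) ∷ descents (y ∷ v)) (p ∷ q ∷ a)) (vr ʳ++ y ∷ v) ∎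
  where
  open ≡-Reasoning
  colour : ∀ vr → before vr y ≡ firstColour vr (y ∷ v)
  colour []       = refl
  colour (x ∷ vr) = refl
  shift : ∀ p → rword vr ar ʳ++ weave (p ∷ q ∷ a) (y ∷ v) ≡ (replicate p 0 ++ rword vr ar) ʳ++ y ∷ weave (q ∷ a) v
  shift p = trans
    (cong (rword vr ar ʳ++_) (trans (sym (replicate-weave₀ p (q ∷ a) (y ∷ v))) (sym (replicate-ʳ++ p 0 _))))
    (sym (++-ʳ++ (replicate p 0)))

F-weave : ∀ p a v → length a ≡ length v → All (0 <_) v →
  F (weave (p ∷ a) v) ≡ weave (run [] (true ∷ descents v) (p ∷ a)) v
F-weave p a v len pos = F-weave-from v p a [] [] len pos refl []

-- Insertions seen through ZDer

bump-≤ : ∀ {i x} → x ≤ i → bump i x ≡ x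
bump-≤ p rewrite ≤ᵇ-true p = refl

bump-> : ∀ {i x} → i < x → bump i x ≡ suc x
bump-> p rewrite ≤ᵇ-false p = refl

≡ᵇ-true : ∀ {m n} → m ≡ n → (m ≡ᵇ n) ≡ true
≡ᵇ-true {zero}  refl = refl
≡ᵇ-true {suc m} refl = ≡ᵇ-true {m} refl

≡ᵇ-false : ∀ {m n} → m ≢ n → (m ≡ᵇ n) ≡ false
≡ᵇ-false {zero}  {zero}  n = ⊥-elim (n refl)
≡ᵇ-false {zero}  {suc n} _ = refl
≡ᵇ-false {suc m} {zero}  _ = refl
≡ᵇ-false {suc m} {suc n} f = ≡ᵇ-false {m} {n} (f ∘ cong suc)

≡ᵇ-sym : ∀ m n → (m ≡ᵇ n) ≡ (n ≡ᵇ m)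
≡ᵇ-sym zero    zero    = refl
≡ᵇ-sym zero    (suc n) = refl
≡ᵇ-sym (suc m) zero    = refl
≡ᵇ-sym (suc m) (suc n) = ≡ᵇ-sym m n

bump-fixed-≤ : ∀ i p x → p ≤ i → (p ≡ᵇ bump i x) ≡ (p ≡ᵇ x)
bump-fixed-≤ i p x p≤i with x ≤? i
... | yes x≤i rewrite bump-≤ x≤i = refl
... | no  x≰i rewrite bump-> (≰⇒> x≰i) = trans
  (≡ᵇ-false {p} {suc x} (<⇒≢ (<-trans (≤-<-trans p≤i (≰⇒> x≰i)) (n<1+n x))))
  (sym (≡ᵇ-false {p} {x} (<⇒≢ (≤-<-trans p≤i (≰⇒> x≰i)))))

bump-fixed-> : ∀ i p x → i < p → (suc p ≡ᵇ bump i x) ≡ (p ≡ᵇ x)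
bump-fixed-> i p x i<p with x ≤? i
... | yes x≤i rewrite bump-≤ x≤i = trans
  (≡ᵇ-false {suc p} {x} (>⇒≢ (m<n⇒m<1+n (≤-<-trans x≤i i<p))))
  (sym (≡ᵇ-false {p} {x} (>⇒≢ (≤-<-trans x≤i i<p))))
... | no  x≰i rewrite bump-> (≰⇒> x≰i) = refl

bump-<ᵇ : ∀ i y x → (bump i y <ᵇ bump i x) ≡ (y <ᵇ x)
bump-<ᵇ i y x with y ≤? i | x ≤? i
... | yes p | yes q rewrite bump-≤ p | bump-≤ q = refl
... | yes p | no  q rewrite bump-≤ p | bump-> (≰⇒> q) = trans
  (<ᵇ-true (m<n⇒m<1+n (≤-<-trans p (≰⇒> q)))) (sym (<ᵇ-true (≤-<-trans p (≰⇒> q))))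
... | no  p | yes q rewrite bump-> (≰⇒> p) | bump-≤ q = trans
  (<ᵇ-false (≤-trans q (<⇒≤ (<-trans (≰⇒> p) (n<1+n y))))) (sym (<ᵇ-false (≤-trans q (<⇒≤ (≰⇒> p)))))
... | no  p | no  q rewrite bump-> (≰⇒> p) | bump-> (≰⇒> q) = refl

indexed-++ : ∀ k xs ys → indexed k (xs ++ ys) ≡ indexed k xs ++ indexed (length xs + k) ys
indexed-++ k []       ys = refl
indexed-++ k (x ∷ xs) ys = cong ((k , x) ∷_) (trans (indexed-++ (suc k) xs ys)
  (cong (λ j → indexed (suc k) xs ++ indexed j ys) (+-suc (length xs) k)))

moved : ℕ × ℕ → Bool
moved px = not (proj₁ px ≡ᵇ proj₂ px)

nonFixed : ℕ → List ℕ → List ℕ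
nonFixed k xs = map proj₂ (filterᵇ moved (indexed k xs))

letter : List ℕ → ℕ × ℕ → ℕ
letter N (p , x) = if p ≡ᵇ x then 0 else suc (count (_<ᵇ x) N)

nonFixed-++ : ∀ k xs ys → nonFixed k (xs ++ ys) ≡ nonFixed k xs ++ nonFixed (length xs + k) ys
nonFixed-++ k xs ys = trans (cong (map proj₂ ∘ filterᵇ moved) (indexed-++ k xs ys))
  (trans (cong (map proj₂) (filter-++ (T? ∘ moved) (indexed k xs) _)) (map-++ proj₂ (filterᵇ moved (indexed k xs)) _))

nonFixed-≤ : ∀ i k xs → length xs + k ≤ suc i → nonFixed k (map (bump i) xs) ≡ map (bump i) (nonFixed k xs)
nonFixed-≤ i k []       h = refl
nonFixed-≤ i k (x ∷ xs) h
  rewrite bump-fixed-≤ i k x (m+n≤o⇒n≤o (length xs) (s≤s⁻¹ h)) with k ≡ᵇ x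
... | true  = nonFixed-≤ i (suc k) xs (subst (_≤ suc i) (sym (+-suc (length xs) k)) h)
... | false = cong (bump i x ∷_) (nonFixed-≤ i (suc k) xs (subst (_≤ suc i) (sym (+-suc (length xs) k)) h))

nonFixed-> : ∀ i k xs → i < k → nonFixed (suc k) (map (bump i) xs) ≡ map (bump i) (nonFixed k xs)
nonFixed-> i k []       h = refl
nonFixed-> i k (x ∷ xs) h rewrite bump-fixed-> i k x h with k ≡ᵇ x
... | true  = nonFixed-> i (suc k) xs (m<n⇒m<1+n h)
... | false = cong (bump i x ∷_) (nonFixed-> i (suc k) xs (m<n⇒m<1+n h))

count-bump : ∀ i x N → count (_<ᵇ bump i x) (map (bump i) N) ≡ count (_<ᵇ x) N
count-bump i x []      = refl
count-bump i x (y ∷ N) rewrite bump-<ᵇ i y x with y <ᵇ x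
... | true  = cong suc (count-bump i x N)
... | false = count-bump i x N

letters-≤ : ∀ i N k xs → length xs + k ≤ suc i →
  map (letter (map (bump i) N)) (indexed k (map (bump i) xs)) ≡ map (letter N) (indexed k xs)
letters-≤ i N k []       h = refl
letters-≤ i N k (x ∷ xs) h
  rewrite bump-fixed-≤ i k x (m+n≤o⇒n≤o (length xs) (s≤s⁻¹ h)) | count-bump i x N
  = cong (letter N (k , x) ∷_) (letters-≤ i N (suc k) xs (subst (_≤ suc i) (sym (+-suc (length xs) k)) h))

letters-> : ∀ i N k xs → i < k →
  map (letter (map (bump i) N)) (indexed (suc k) (map (bump i) xs)) ≡ map (letter N) (indexed k xs)
letters-> i N k []       h = refl
letters-> i N k (x ∷ xs) h rewrite bump-fixed-> i k x h | count-bump i x N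
  = cong (letter N (k , x) ∷_) (letters-> i N (suc k) xs (m<n⇒m<1+n h))

length-indexed : ∀ k xs → length (indexed k xs) ≡ length xs
length-indexed k []       = refl
length-indexed k (x ∷ xs) = cong suc (length-indexed (suc k) xs)

length-ZDer : ∀ τ → length (ZDer τ) ≡ length τ
length-ZDer τ = trans (length-map _ (indexed 1 τ)) (length-indexed 1 τ)

take-++ˡ : ∀ (xs ys : List ℕ) → take (length xs) (xs ++ ys) ≡ xs
take-++ˡ []       ys = refl
take-++ˡ (x ∷ xs) ys = cong (x ∷_) (take-++ˡ xs ys)

drop-++ˡ : ∀ (xs ys : List ℕ) → drop (length xs) (xs ++ ys) ≡ ys
drop-++ˡ []       ys = refl
drop-++ˡ (x ∷ xs) ys = drop-++ˡ xs ys

-- `bump i` is strictly increasing, which preserves ranks, and it shifts values above i exactly as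
-- the insertion shifts positions, which preserves being fixed. So the old letters of `ZDer` survive
-- and the new fixed point adds a 0.
ZDer-insert : ∀ xs ys → let i = length xs; z = ZDer (xs ++ ys) in
  ZDer (map (bump i) xs ++ suc i ∷ map (bump i) ys) ≡ take i z ++ 0 ∷ drop i z
ZDer-insert xs ys = begin
  map (letter (nonFixed 1 new)) (indexed 1 new)
    ≡⟨ cong₂ (λ N l → map (letter N) l) N-eq (indexed-++ 1 (map (bump i) xs) _) ⟩
  map (letter N') (indexed 1 (map (bump i) xs) ++ (len' , suc i) ∷ indexed (suc len') (map (bump i) ys))
    ≡⟨ cong (λ k → map (letter N') (indexed 1 (map (bump i) xs) ++ (k , suc i) ∷ indexed (suc k) (map (bump i) ys))) len'≡ ⟩
  map (letter N') (indexed 1 (map (bump i) xs) ++ (suc i , suc i) ∷ indexed (2 + i) (map (bump i) ys))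
    ≡⟨ map-++ (letter N') (indexed 1 (map (bump i) xs)) _ ⟩
  map (letter N') (indexed 1 (map (bump i) xs)) ++ letter N' (suc i , suc i) ∷ map (letter N') (indexed (2 + i) (map (bump i) ys))
    ≡⟨ cong₂ _++_ (letters-≤ i N 1 xs (≤-reflexive (+-comm i 1)))
         (cong₂ _∷_ (cong (λ b → if b then 0 else suc (count (_<ᵇ suc i) N')) (≡ᵇ-true {i} refl))
           (letters-> i N (suc i) ys ≤-refl)) ⟩
  zx ++ 0 ∷ zy
    ≡⟨ cong₂ (λ a b → a ++ 0 ∷ b) (sym take-z) (sym drop-z) ⟩
  take i (ZDer (xs ++ ys)) ++ 0 ∷ drop i (ZDer (xs ++ ys)) ∎
  where
  open ≡-Reasoning
  i = length xs
  new = map (bump i) xs ++ suc i ∷ map (bump i) ys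
  N = nonFixed 1 (xs ++ ys)
  N' = map (bump i) N
  len' = length (map (bump i) xs) + 1
  len'≡ : len' ≡ suc i
  len'≡ = trans (cong (_+ 1) (length-map (bump i) xs)) (+-comm i 1)
  zx = map (letter N) (indexed 1 xs)
  zy = map (letter N) (indexed (suc i) ys)
  z-split : ZDer (xs ++ ys) ≡ zx ++ zy
  z-split = trans (cong (map (letter N)) (trans (indexed-++ 1 xs ys)
    (cong (λ k → indexed 1 xs ++ indexed k ys) (+-comm i 1)))) (map-++ (letter N) (indexed 1 xs) _)
  zx-length : length zx ≡ i
  zx-length = trans (length-map (letter N) (indexed 1 xs)) (length-indexed 1 xs)
  take-z : take i (ZDer (xs ++ ys)) ≡ zx
  take-z = trans (cong₂ take (sym zx-length) z-split) (take-++ˡ zx zy)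
  drop-z : drop i (ZDer (xs ++ ys)) ≡ zy
  drop-z = trans (cong₂ drop (sym zx-length) z-split) (drop-++ˡ zx zy)
  fixed : nonFixed (suc i) (suc i ∷ map (bump i) ys) ≡ nonFixed (2 + i) (map (bump i) ys)
  fixed rewrite ≡ᵇ-true {i} refl = refl
  N-eq : nonFixed 1 new ≡ N'
  N-eq = begin
    nonFixed 1 new
      ≡⟨ nonFixed-++ 1 (map (bump i) xs) _ ⟩
    nonFixed 1 (map (bump i) xs) ++ nonFixed len' (suc i ∷ map (bump i) ys)
      ≡⟨ cong (λ k → nonFixed 1 (map (bump i) xs) ++ nonFixed k (suc i ∷ map (bump i) ys)) len'≡ ⟩
    nonFixed 1 (map (bump i) xs) ++ nonFixed (suc i) (suc i ∷ map (bump i) ys)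
      ≡⟨ cong₂ _++_ (nonFixed-≤ i 1 xs (≤-reflexive (+-comm i 1))) (trans fixed (nonFixed-> i (suc i) ys ≤-refl)) ⟩
    map (bump i) (nonFixed 1 xs) ++ map (bump i) (nonFixed (suc i) ys)
      ≡⟨ sym (map-++ (bump i) (nonFixed 1 xs) _) ⟩
    map (bump i) (nonFixed 1 xs ++ nonFixed (suc i) ys)
      ≡⟨ cong (map (bump i)) (trans (cong (λ k → nonFixed 1 xs ++ nonFixed k ys) (+-comm 1 i)) (sym (nonFixed-++ 1 xs ys))) ⟩
    N' ∎

length-take-≤ : ∀ i (τ : List ℕ) → i ≤ length τ → length (take i τ) ≡ i
length-take-≤ i τ h = trans (length-take i τ) (m≤n⇒m⊓n≡m h)

ZDer-insertAt : ∀ τ i → i ≤ length τ → ZDer (insertAt τ i) ≡ take i (ZDer τ) ++ 0 ∷ drop i (ZDer τ)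
ZDer-insertAt τ i h with ZDer-insert (take i τ) (drop i τ)
... | e rewrite length-take-≤ i τ h | take++drop≡id i τ = e

nonzeroIndices : ℕ → List ℕ → List ℕ
nonzeroIndices k w = map proj₁ (filterᵇ (λ px → nz (proj₂ px)) (indexed k w))

slotList-ZDer : ∀ τ → slotList τ ≡ 0 ∷ nonzeroIndices 1 (ZDer τ)
slotList-ZDer τ rewrite range≡seq 1 (length τ) = cong (0 ∷_)
  (trans (filter-positions (λ x p → not (x ≡ᵇ p)) [] τ) (go 1 τ))
  where
  N = nonFixed 1 τ
  go : ∀ k xs → map proj₁ (filterᵇ (λ (p , x) → not (x ≡ᵇ p)) (indexed k xs)) ≡
    nonzeroIndices k (map (letter N) (indexed k xs))
  go k []       = refl
  go k (x ∷ xs) rewrite ≡ᵇ-sym x k with k ≡ᵇ x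
  ... | true  = go (suc k) xs
  ... | false = cong (k ∷_) (go (suc k) xs)

incAt : ℕ → List ℕ → List ℕ
incAt j       []      = []
incAt zero    (p ∷ a) = suc p ∷ a
incAt (suc j) (p ∷ a) = p ∷ incAt j a

incAt-length : ∀ j a → length (incAt j a) ≡ length a
incAt-length j       []      = refl
incAt-length zero    (p ∷ a) = refl
incAt-length (suc j) (p ∷ a) = cong suc (incAt-length j a)

-- The zero comes directly behind a nonzero letter, hence before the zeros already in that slot; the
-- contents record only their number.
insert-weave : ∀ k p a v j → length a ≡ length v → All (0 <_) v → j < length v →
  ∃ λ i → get0 (nonzeroIndices (suc k) (weave (p ∷ a) v)) j ≡ i + suc k × i < length (weave (p ∷ a) v) ×
    take (suc i) (weave (p ∷ a) v) ++ 0 ∷ drop (suc i) (weave (p ∷ a) v) ≡ weave (incAt (suc j) (p ∷ a)) v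
insert-weave k (suc p) a v j len pos j<n with insert-weave (suc k) p a v j len pos j<n
... | i , e , i< , w = suc i , trans e (+-suc i (suc k)) , s≤s i< , cong (0 ∷_) w
insert-weave k zero (q ∷ a) (suc x ∷ v) zero    len (_ ∷ pos) j<n = 0 , refl , z<s , refl
insert-weave k zero (q ∷ a) (suc x ∷ v) (suc j) len (_ ∷ pos) j<n
  with insert-weave (suc k) q a v j (suc-injective len) pos (s≤s⁻¹ j<n)
... | i , e , i< , w = suc i , trans e (+-suc i (suc k)) , s≤s i< , cong (suc x ∷_) w

ZDer-ins : ∀ τ a v j → length a ≡ suc (length v) → All (0 <_) v → j ≤ length v →
  ZDer τ ≡ weave a v → ZDer (ins τ j) ≡ weave (incAt j a) v
ZDer-ins τ (p ∷ a) v zero len pos j≤n e =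
  trans (ZDer-insertAt τ 0 z≤n) (cong (0 ∷_) e)
ZDer-ins τ (p ∷ a) v (suc j) len pos j≤n e
  with insert-weave 0 p a v j (suc-injective len) pos j≤n
... | i , e' , i< , w = trans (cong (ZDer ∘ insertAt τ) slot)
  (trans (ZDer-insertAt τ (suc i) (subst (i <_) (trans (cong length (sym e)) (length-ZDer τ)) i<))
    (trans (cong (λ z → take (suc i) z ++ 0 ∷ drop (suc i) z) e) w))
  where
  slot : slotPos τ (suc j) ≡ suc i
  slot = trans (cong (λ l → get0 l (suc j)) (trans (slotList-ZDer τ) (cong (λ z → 0 ∷ nonzeroIndices 1 z) e)))
    (trans e' (+-comm i 1))

ZDer-insertSeq : ∀ τ a v js → length a ≡ suc (length v) → All (0 <_) v → All (_≤ length v) js →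
  ZDer τ ≡ weave a v → ZDer (insertSeq τ js) ≡ weave (foldl (flip incAt) a js) v
ZDer-insertSeq τ a v []       len pos []        e = e
ZDer-insertSeq τ a v (j ∷ js) len pos (j≤ ∷ js≤) e =
  ZDer-insertSeq (ins τ j) (incAt j a) v js (trans (incAt-length j a) len) pos js≤ (ZDer-ins τ a v j len pos j≤ e)

-- Bounds and ranks of the letters of a permutation.

count-↭ : ∀ p {xs ys} → xs ↭ ys → count p xs ≡ count p ys
count-↭ p h = ↭-length (filter-↭ _ h)

length-seq : ∀ a n → length (seq a n) ≡ n
length-seq a zero    = refl
length-seq a (suc n) = cong suc (length-seq (suc a) n)

seq-bounds : ∀ a n → All (λ x → a ≤ x × x < a + n) (seq a n)
seq-bounds a zero    = []
seq-bounds a (suc n) = (≤-refl , m<m+n a z<s) ∷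
  All.map (λ {x} (l , u) → <⇒≤ l , subst (x <_) (sym (+-suc a n)) u) (seq-bounds (suc a) n)

count-<-seq : ∀ x a n → a ≤ x → x ≤ a + n → count (_<ᵇ x) (seq a n) ≡ x ∸ a
count-<-seq x a zero    a≤x x≤ = sym (m≤n⇒m∸n≡0 (subst (x ≤_) (+-identityʳ a) x≤))
count-<-seq x a (suc n) a≤x x≤ with a <? x
... | yes a<x rewrite <ᵇ-true a<x = trans
  (cong suc (count-<-seq x (suc a) n a<x (subst (x ≤_) (+-suc a n) x≤)))
  (sym (+-∸-assoc 1 a<x))
... | no a≮x with ≤-antisym a≤x (≮⇒≥ a≮x)
...   | refl rewrite <ᵇ-false {a} {a} ≤-refl | n∸n≡0 a = none n (suc a) (n≤1+n a)
  where
  none : ∀ n b → a ≤ b → count (_<ᵇ a) (seq b n) ≡ 0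
  none zero    b h = refl
  none (suc n) b h rewrite <ᵇ-false h = none n (suc b) (m≤n⇒m≤1+n h)

module _ {k σ} (perm : IsPerm k σ) where

  perm-bounds : All (λ x → 0 < x × x ≤ k) σ
  perm-bounds = All.map (λ (l , u) → l , s≤s⁻¹ u)
    (All-resp-↭ (↭-sym perm) (subst (All _) (sym (range≡seq 1 k)) (seq-bounds 1 k)))

  perm-length : length σ ≡ k
  perm-length = trans (↭-length perm) (trans (cong length (range≡seq 1 k)) (length-seq 1 k))

  perm-rank : ∀ {x} → 0 < x → x ≤ k → suc (count (_<ᵇ x) σ) ≡ x
  perm-rank {suc x} 0<x x≤k = cong suc (trans (count-↭ _ perm)
    (trans (cong (count (_<ᵇ suc x)) (range≡seq 1 k)) (count-<-seq (suc x) 1 k 0<x (m≤n⇒m≤1+n x≤k))))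

weave-zeros : ∀ v → weave (replicate (suc (length v)) 0) v ≡ v
weave-zeros []      = refl
weave-zeros (x ∷ v) = cong (x ∷_) (weave-zeros v)

ZDer-derangement : ∀ {k σ} → IsDerangement k σ → ZDer σ ≡ σ
ZDer-derangement {k} {σ} (perm , der) = trans (cong (λ N → map (letter N) (indexed 1 σ)) (unfixed 1 σ der))
  (go 1 σ der (perm-bounds perm))
  where
  unfixed : ∀ p xs → All (λ px → proj₁ px ≢ proj₂ px) (indexed p xs) → nonFixed p xs ≡ xs
  unfixed p []       []       = refl
  unfixed p (x ∷ xs) (d ∷ ds) rewrite ≡ᵇ-false d = cong (x ∷_) (unfixed (suc p) xs ds)
  go : ∀ p xs → All (λ px → proj₁ px ≢ proj₂ px) (indexed p xs) → All (λ x → 0 < x × x ≤ k) xs →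
    map (letter σ) (indexed p xs) ≡ xs
  go p []       []       []             = refl
  go p (x ∷ xs) (d ∷ ds) ((l , u) ∷ bs) rewrite ≡ᵇ-false d =
    cong₂ _∷_ (perm-rank perm l u) (go (suc p) xs ds bs)

-- Green slots, their values, and Ψ

NoFixed : ℕ → List ℕ → Set
NoFixed k xs = All (λ px → proj₁ px ≢ proj₂ px) (indexed k xs)

get0-seq : ∀ a n j → j < n → get0 (seq a n) j ≡ a + j
get0-seq a (suc n) zero    _ = sym (+-identityʳ a)
get0-seq a (suc n) (suc j) (s≤s j<n) = trans (get0-seq (suc a) n j j<n) (sym (+-suc a j))

slotPos-derangement : ∀ σ → NoFixed 1 σ → ∀ j → j ≤ length σ → slotPos σ j ≡ j
slotPos-derangement σ der j j≤n = trans
  (cong (λ l → get0 (0 ∷ l) j) (trans (cong (filterᵇ _) (range≡seq 1 (length σ)))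
    (trans (filter-positions (λ x p → not (x ≡ᵇ p)) [] σ) (go 1 σ der))))
  (get0-seq 0 (suc (length σ)) j (s≤s j≤n))
  where
  go : ∀ k xs → NoFixed k xs → map proj₁ (filterᵇ (λ (p , x) → not (x ≡ᵇ p)) (indexed k xs)) ≡ seq k (length xs)
  go k []       []       = refl
  go k (x ∷ xs) (d ∷ ds) rewrite ≡ᵇ-false (d ∘ sym) = cong (k ∷_) (go (suc k) xs ds)

des-map-bump : ∀ i l → des (map (bump i) l) ≡ des l
des-map-bump i []          = refl
des-map-bump i (x ∷ [])    = refl
des-map-bump i (x ∷ y ∷ l) = cong₂ (λ b d → (if b then 1 else 0) + d) (bump-<ᵇ i y x) (des-map-bump i (y ∷ l))

des-ʳ++ : ∀ x pre u → des ((x ∷ pre) ʳ++ u) ≡ des (reverse (x ∷ pre)) + des (x ∷ u)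
des-ʳ++ x []        u = refl
des-ʳ++ x (y ∷ pre) u = trans (des-ʳ++ y pre (x ∷ u))
  (trans (sym (+-assoc (des (reverse (y ∷ pre))) _ _)) (cong (_+ des (x ∷ u)) (sym (des-reverse x y pre))))

+-cancel-≡ᵇ : ∀ d m n → (d + m ≡ᵇ d + n) ≡ (m ≡ᵇ n)
+-cancel-≡ᵇ zero    m n = refl
+-cancel-≡ᵇ (suc d) m n = +-cancel-≡ᵇ d m n

+-cancel-≡ᵇʳ : ∀ m n d → (m + d ≡ᵇ n + d) ≡ (m ≡ᵇ n)
+-cancel-≡ᵇʳ m n d = trans (cong₂ _≡ᵇ_ (+-comm m d) (+-comm n d)) (+-cancel-≡ᵇ d m n)

insertAt-ʳ++ : ∀ pre u → let j = length pre in
  insertAt (pre ʳ++ u) j ≡ map (bump j) pre ʳ++ suc j ∷ map (bump j) u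
insertAt-ʳ++ pre u = trans
  (cong₂ (λ a b → map (bump j) a ++ suc j ∷ map (bump j) b) (take-len pre u)
    (trans (cong (λ i → drop i (pre ʳ++ u)) (sym (+-identityʳ j))) (drop-ʳ++ pre 0 u)))
  (trans (cong (_++ suc j ∷ map (bump j) u) (map-ʳ++ (bump j) pre)) (sym (ʳ++-defn (map (bump j) pre))))
  where
  j = length pre

-- With `suc j` between `y` and `z`, a descent on its left means that `y` is not subexcedent, and
-- one on its right that `z` is. Their number is compared with the single possible descent from `y`
-- to `z`, whose presence is forced when just one of the two letters is subexcedent.
green-des : ∀ r y v → 0 < y → y ≢ suc r → All (λ x → 0 < x) v → NoFixed (2 + r) v → All (_≤ suc r + length v) (y ∷ v) →
  let j = suc r in (des (bump j y ∷ suc j ∷ map (bump j) v) ≡ᵇ des (y ∷ v)) ≡ green r y v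
green-des r y [] 0<y y≢ _ _ (y≤ ∷ []) = trans lhs (sym rhs)
  where
  -- A last letter does not exceed its position and is not fixed, hence it is subexcedent, and
  -- inserting the new maximum behind it creates no descent.
  y≤r : y ≤ r
  y≤r = s≤s⁻¹ (≤∧≢⇒< (subst (y ≤_) (+-identityʳ (suc r)) y≤) y≢)
  lhs : (des (bump (suc r) y ∷ suc (suc r) ∷ []) ≡ᵇ 0) ≡ true
  lhs rewrite bump-≤ {suc r} {y} (m≤n⇒m≤1+n y≤r) | <ᵇ-false {suc (suc r)} {y} (≤-trans y≤r (m≤n+m r 2)) = refl
  rhs : green r y [] ≡ true
  rhs rewrite sub-≤ 0<y y≤r = refl
green-des r y (z ∷ v) 0<y y≢ (0<z ∷ _) (z≢ ∷ _) _ = begin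
  ((if suc j <ᵇ bump j y then 1 else 0) + ((if bump j z <ᵇ suc j then 1 else 0) + des (map (bump j) (z ∷ v)))
    ≡ᵇ (if z <ᵇ y then 1 else 0) + d)
    ≡⟨ cong₂ (λ a (b , d') → ((if a then 1 else 0) + ((if b then 1 else 0) + d') ≡ᵇ (if z <ᵇ y then 1 else 0) + d))
         left (cong₂ _,_ right (des-map-bump j (z ∷ v))) ⟩
  ((if not (sub r y) then 1 else 0) + ((if sub j z then 1 else 0) + d) ≡ᵇ (if z <ᵇ y then 1 else 0) + d)
    ≡⟨ cong (_≡ᵇ (if z <ᵇ y then 1 else 0) + d) (sym (+-assoc (if not (sub r y) then 1 else 0) _ d)) ⟩
  ((if not (sub r y) then 1 else 0) + (if sub j z then 1 else 0) + d ≡ᵇ (if z <ᵇ y then 1 else 0) + d)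
    ≡⟨ +-cancel-≡ᵇʳ ((if not (sub r y) then 1 else 0) + (if sub j z then 1 else 0)) _ d ⟩
  ((if not (sub r y) then 1 else 0) + (if sub j z then 1 else 0) ≡ᵇ (if z <ᵇ y then 1 else 0))
    ≡⟨ finish (sub r y) (sub j z) (z <ᵇ y) mixed₁ mixed₂ ⟩
  green r y (z ∷ v) ∎
  where
  open ≡-Reasoning
  j = suc r
  d = des (z ∷ v)
  nonsub : ∀ r y → r < y → sub r y ≡ false
  nonsub r (suc y) h = <ᵇ-false h
  left : (suc j <ᵇ bump j y) ≡ not (sub r y)
  left with y ≤? r
  ... | yes p rewrite bump-≤ {j} {y} (m≤n⇒m≤1+n p) | sub-≤ 0<y p = <ᵇ-false (≤-trans p (m≤n+m r 2))
  ... | no  p = trans (cong (suc j <ᵇ_) (bump-> j<y)) (trans (<ᵇ-true (s≤s j<y)) (cong not (sym (nonsub r y (<⇒≤ j<y)))))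
    where
    j<y : j < y
    j<y = ≤∧≢⇒< (≰⇒> p) (y≢ ∘ sym)
  right : (bump j z <ᵇ suc j) ≡ sub j z
  right with z ≤? j
  ... | yes p = trans (cong (_<ᵇ suc j) (bump-≤ p)) (trans (<ᵇ-true (s≤s p)) (sym (sub-≤ 0<z p)))
  ... | no  p = trans (cong (_<ᵇ suc j) (bump-> (≰⇒> p)))
    (trans (<ᵇ-false (m≤n⇒m≤1+n (≰⇒> p))) (sym (nonsub j z (≰⇒> p))))
  mixed₁ : sub r y ≡ true → sub j z ≡ false → (z <ᵇ y) ≡ false
  mixed₁ s t = <ᵇ-false (≤-trans (proj₂ (sub-parts {r} {y} s)) (≤-trans (n≤1+n r) (<⇒≤ (nonsub-≥ 0<z t))))
  mixed₂ : sub r y ≡ false → sub j z ≡ true → (z <ᵇ y) ≡ true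
  mixed₂ s t = <ᵇ-true (≤-<-trans (proj₂ (sub-parts {j} {z} t)) (≤∧≢⇒< (nonsub-≥ 0<y s) (y≢ ∘ sym)))
  finish : ∀ s t b → (s ≡ true → t ≡ false → b ≡ false) → (s ≡ false → t ≡ true → b ≡ true) →
    ((if not s then 1 else 0) + (if t then 1 else 0) ≡ᵇ (if b then 1 else 0)) ≡
    (if s then (if t then b else true) else (if t then false else b))
  finish true  true  true  f g = refl
  finish true  true  false f g = refl
  finish true  false b     f g rewrite f refl refl = refl
  finish false true  b     f g rewrite g refl refl = refl
  finish false false true  f g = refl
  finish false false false f g = refl

-- The letters up to `y` keep their relative order under `bump`, so the descents among them cancel.
isGreen-eq : ∀ σ → NoFixed 1 σ → ∀ y pre v → σ ≡ (y ∷ pre) ʳ++ v → let r = length pre in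
  0 < y → y ≢ suc r → All (0 <_) v → NoFixed (2 + r) v → All (_≤ suc r + length v) (y ∷ v) →
  isGreen σ (suc r) ≡ green r y v
isGreen-eq σ der y pre v refl 0<y y≢ pos nf bd = begin
  (des (ins σ j) ≡ᵇ des σ)
    ≡⟨ cong₂ _≡ᵇ_ (cong (des ∘ insertAt σ) (slotPos-derangement σ der j j≤)) (des-ʳ++ y pre v) ⟩
  (des (insertAt σ j) ≡ᵇ D + des (y ∷ v))
    ≡⟨ cong (λ w → des w ≡ᵇ D + des (y ∷ v)) (insertAt-ʳ++ (y ∷ pre) v) ⟩
  (des ((bump j y ∷ map (bump j) pre) ʳ++ suc j ∷ map (bump j) v) ≡ᵇ D + des (y ∷ v))
    ≡⟨ cong (_≡ᵇ D + des (y ∷ v)) (des-ʳ++ (bump j y) (map (bump j) pre) _) ⟩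
  (des (reverse (map (bump j) (y ∷ pre))) + E ≡ᵇ D + des (y ∷ v))
    ≡⟨ cong (λ n → n + E ≡ᵇ D + des (y ∷ v))
         (trans (cong des (sym (reverse-map (bump j) (y ∷ pre)))) (des-map-bump j (reverse (y ∷ pre)))) ⟩
  (D + E ≡ᵇ D + des (y ∷ v))
    ≡⟨ +-cancel-≡ᵇ D E _ ⟩
  (E ≡ᵇ des (y ∷ v))
    ≡⟨ green-des (length pre) y v 0<y y≢ pos nf bd ⟩
  green (length pre) y v ∎
  where
  open ≡-Reasoning
  j = suc (length pre)
  D = des (reverse (y ∷ pre))
  E = des (bump j y ∷ suc j ∷ map (bump j) v)
  j≤ : j ≤ length σ
  j≤ = subst (j ≤_) (sym (length-ʳ++ (y ∷ pre) {v})) (m≤m+n j (length v))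

isGreen-first : ∀ σ → All (0 <_) σ → NoFixed 1 σ → isGreen σ 0 ≡ true
isGreen-first []      _            _          = refl
isGreen-first (y ∷ v) (0<y ∷ pos) (1≢y ∷ nf) = begin
  ((if bump 0 y <ᵇ 1 then 1 else 0) + des (map (bump 0) (y ∷ v)) ≡ᵇ des (y ∷ v))
    ≡⟨ cong₂ (λ b n → (if b then 1 else 0) + n ≡ᵇ des (y ∷ v))
         (trans (cong (_<ᵇ 1) (bump-> 0<y)) refl) (des-map-bump 0 (y ∷ v)) ⟩
  (des (y ∷ v) ≡ᵇ des (y ∷ v))
    ≡⟨ ≡ᵇ-true {des (y ∷ v)} refl ⟩
  true ∎
  where open ≡-Reasoning

greens-isGreen : ∀ σ → NoFixed 1 σ → ∀ pre v → σ ≡ pre ʳ++ v → let r = length pre in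
  All (0 <_) v → NoFixed (suc r) v → All (_≤ r + length v) v →
  greens r v ≡ map (isGreen σ) (seq (suc r) (length v))
greens-isGreen σ der pre []      e pos       nf       bd       = refl
greens-isGreen σ der pre (y ∷ v) e (0<y ∷ pos) (r≢y ∷ nf) bd =
  cong₂ _∷_ (sym (isGreen-eq σ der y pre v e 0<y (r≢y ∘ sym) pos nf bd'))
    (greens-isGreen σ der (y ∷ pre) v e pos nf (All.tail bd'))
  where
  bd' : All (_≤ suc (length pre) + length v) (y ∷ v)
  bd' = subst (λ n → All (_≤ n) (y ∷ v)) (+-suc (length pre) (length v)) bd

isGreen-colours : ∀ {k σ} → IsDerangement k σ →
  true ∷ greens 0 σ ≡ map (isGreen σ) (seq 0 (suc (length σ)))
isGreen-colours {k} {σ} (perm , der) = cong₂ _∷_ (sym (isGreen-first σ pos der))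
  (greens-isGreen σ der [] σ refl pos der
    (All.map (λ {x} p → subst (x ≤_) (sym (perm-length perm)) (proj₂ p)) (perm-bounds perm)))
  where
  pos : All (0 <_) σ
  pos = All.map proj₁ (perm-bounds perm)

-- Slot values as numbers of green slots to the right.

count-++ : ∀ p xs ys → count p (xs ++ ys) ≡ count p xs + count p ys
count-++ p xs ys = trans (cong length (filter-++ (T? ∘ p) xs ys)) (length-++ (filterᵇ p xs))

count-seq-cong : ∀ f h a n → (∀ x → a ≤ x → x < a + n → f x ≡ h x) → count f (seq a n) ≡ count h (seq a n)
count-seq-cong f h a zero    e = refl
count-seq-cong f h a (suc n) e = trans (count-∷ f a (seq (suc a) n)) (trans
  (cong₂ (λ b m → (if b then 1 else 0) + m) (e a ≤-refl (m<m+n a z<s))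
    (count-seq-cong f h (suc a) n λ x l u → e x (<⇒≤ l) (subst (x <_) (sym (+-suc a n)) u)))
  (sym (count-∷ h a (seq (suc a) n))))

count-none : ∀ l → count (λ _ → false) l ≡ 0
count-none []      = refl
count-none (x ∷ l) = count-none l

count-not : ∀ g l → count g l + count (not ∘ g) l ≡ length l
count-not g []      = refl
count-not g (x ∷ l) with g x
... | true  = cong suc (count-not g l)
... | false = trans (+-suc _ _) (cong suc (count-not g l))

upTo≡seq : ∀ n → upTo n ≡ seq 0 n
upTo≡seq n = trans (sym (map-id (upTo n))) (range≡seq 0 n)

seq-split : ∀ s m → seq 0 (s + suc m) ≡ seq 0 s ++ s ∷ seq (suc s) m
seq-split s m = seq-++ 0 s (suc m)

module _ (g : ℕ → Bool) (s m : ℕ) where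

  count-after : count (λ j → g j ∧ (s <ᵇ j)) (seq 0 (s + suc m)) ≡ count g (seq (suc s) m)
  count-after = trans (cong (count _) (seq-split s m)) (trans (count-++ _ (seq 0 s) _)
    (cong₂ _+_
      (trans (count-seq-cong _ (λ _ → false) 0 s λ x _ x<s →
        trans (cong (g x ∧_) (<ᵇ-false (<⇒≤ x<s))) (∧-zeroʳ (g x))) (count-none (seq 0 s)))
      (trans (count-∷ _ s (seq (suc s) m)) (cong₂ (λ b n → (if b then 1 else 0) + n)
        (trans (cong (g s ∧_) (<ᵇ-false {s} ≤-refl)) (∧-zeroʳ (g s)))
        (count-seq-cong _ g (suc s) m λ x s<x _ → trans (cong (g x ∧_) (<ᵇ-true s<x)) (∧-identityʳ (g x)))))))

  count-before : count (λ j → not (g j) ∧ (j <ᵇ s)) (seq 0 (s + suc m)) ≡ count (not ∘ g) (seq 0 s)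
  count-before = trans (cong (count _) (seq-++ 0 s (suc m))) (trans (count-++ _ (seq 0 s) _)
    (trans (cong₂ _+_
      (count-seq-cong _ (not ∘ g) 0 s λ x _ x<s → trans (cong (not (g x) ∧_) (<ᵇ-true x<s)) (∧-identityʳ (not (g x))))
      (trans (count-seq-cong _ (λ _ → false) s (suc m) λ x s≤x _ →
        trans (cong (not (g x) ∧_) (<ᵇ-false s≤x)) (∧-zeroʳ (not (g x)))) (count-none (seq s (suc m)))))
    (+-identityʳ _)))

  -- The green and the red slots to the left of s together number s; what remains of the total is
  -- the number of green slots to its right.
  count-red : g s ≡ false → count g (seq 0 (s + suc m)) + count (not ∘ g) (seq 0 s) ≡ s + count g (seq (suc s) m)
  count-red red = begin
    count g (seq 0 (s + suc m)) + N
      ≡⟨ cong (λ l → count g l + N) (seq-split s m) ⟩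
    count g (seq 0 s ++ s ∷ seq (suc s) m) + N
      ≡⟨ cong (_+ N) (count-++ g (seq 0 s) _) ⟩
    count g (seq 0 s) + count g (s ∷ seq (suc s) m) + N
      ≡⟨ cong (λ n → count g (seq 0 s) + n + N) (trans (count-∷ g s (seq (suc s) m))
           (cong (λ b → (if b then 1 else 0) + G) red)) ⟩
    count g (seq 0 s) + G + N
      ≡⟨ trans (+-assoc (count g (seq 0 s)) G N) (trans (cong (count g (seq 0 s) +_) (+-comm G N))
           (sym (+-assoc (count g (seq 0 s)) N G))) ⟩
    count g (seq 0 s) + N + G
      ≡⟨ cong (_+ G) (trans (count-not g (seq 0 s)) (length-seq 0 s)) ⟩
    s + G ∎
    where
    open ≡-Reasoning
    N = count (not ∘ g) (seq 0 s)
    G = count g (seq (suc s) m)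

slotValue-eq : ∀ σ s m → s + suc m ≡ suc (length σ) → let G = count (isGreen σ) (seq (suc s) m) in
  slotValue σ s ≡ (if isGreen σ s then G else s + G)
slotValue-eq σ s m e = trans
  (cong value (trans (upTo≡seq (suc (length σ))) (cong (seq 0) (sym e))))
  (by-colour (isGreen σ s) refl)
  where
  g = isGreen σ
  value : List ℕ → ℕ
  value slots = if g s then count (λ j → g j ∧ (s <ᵇ j)) slots
    else count g slots + count (λ j → not (g j) ∧ (j <ᵇ s)) slots
  by-colour : ∀ b → g s ≡ b →
    (if b then count (λ j → g j ∧ (s <ᵇ j)) (seq 0 (s + suc m))
      else count g (seq 0 (s + suc m)) + count (λ j → not (g j) ∧ (j <ᵇ s)) (seq 0 (s + suc m))) ≡
    (if b then count g (seq (suc s) m) else s + count g (seq (suc s) m))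
  by-colour true  _   = count-after g s m
  by-colour false red = trans (cong (count g (seq 0 (s + suc m)) +_) (count-before g s m)) (count-red g s m red)

-- The recursion of Ψ as a count of chosen slots.

multiplicity : ℕ → List ℕ → ℕ
multiplicity t = count (t ≡ᵇ_)

get0-replicate-suc : ∀ G p c t → get0 (replicate G 0 ++ suc p ∷ c) t ≡ (if t ≡ᵇ G then 1 else 0) + get0 (replicate G 0 ++ p ∷ c) t
get0-replicate-suc zero    p c zero    = refl
get0-replicate-suc zero    p c (suc t) = refl
get0-replicate-suc (suc G) p c zero    = refl
get0-replicate-suc (suc G) p c (suc t) = get0-replicate-suc G p c t

get0-replicate-+ : ∀ G q p c t →
  get0 (replicate G 0 ++ q + p ∷ c) t ≡ multiplicity t (replicate q G) + get0 (replicate G 0 ++ p ∷ c) t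
get0-replicate-+ G zero    p c t = refl
get0-replicate-+ G (suc q) p c t = trans (get0-replicate-suc G (q + p) c t)
  (trans (cong ((if t ≡ᵇ G then 1 else 0) +_) (get0-replicate-+ G q p c t))
    (trans (sym (+-assoc (if t ≡ᵇ G then 1 else 0) _ _))
      (cong (_+ get0 (replicate G 0 ++ p ∷ c) t) (sym (count-∷ (t ≡ᵇ_) G (replicate q G))))))

get0-∷ʳ : ∀ l t → get0 (l ∷ʳ 0) t ≡ get0 l t
get0-∷ʳ []      zero    = refl
get0-∷ʳ []      (suc t) = refl
get0-∷ʳ (x ∷ l) zero    = refl
get0-∷ʳ (x ∷ l) (suc t) = get0-∷ʳ l t

get0-bumpLast : ∀ G x c t → get0 (replicate G 0 ++ bumpLast (x ∷ c)) t ≡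
  (if t ≡ᵇ length c + G then 1 else 0) + get0 (replicate G 0 ++ x ∷ c) t
get0-bumpLast zero    x []      zero    = refl
get0-bumpLast zero    x []      (suc t) = refl
get0-bumpLast zero    x (y ∷ c) zero    = refl
get0-bumpLast zero    x (y ∷ c) (suc t) = get0-bumpLast zero y c t
get0-bumpLast (suc G) x c       zero    rewrite +-suc (length c) G = refl
get0-bumpLast (suc G) x c       (suc t) rewrite +-suc (length c) G = get0-bumpLast G x c t

multiplicity-map-suc : ∀ l c → (∀ t → multiplicity t l ≡ get0 c t) → ∀ t → multiplicity t (map suc l) ≡ get0 (0 ∷ c) t
multiplicity-map-suc l c h (suc t) = trans (go l) (h t)
  where
  go : ∀ l → multiplicity (suc t) (map suc l) ≡ multiplicity t l
  go []      = refl
  go (x ∷ l) with t ≡ᵇ x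
  ... | true  = cong suc (go l)
  ... | false = go l
multiplicity-map-suc l c h zero = go l
  where
  go : ∀ l → multiplicity 0 (map suc l) ≡ 0
  go []      = refl
  go (x ∷ l) = go l

takeWhile-block : ∀ s q L → All (_< s) L → length (takeWhileᵇ (s ≤ᵇ_) (replicate q s ++ L)) ≡ q
takeWhile-block s zero    []      []        = refl
takeWhile-block s zero    (x ∷ L) (x<s ∷ _) rewrite ≤ᵇ-false x<s = refl
takeWhile-block s (suc q) L       h         rewrite ≤ᵇ-true {s} ≤-refl = cong suc (takeWhile-block s q L h)

dropWhile-block : ∀ s q L → All (_< s) L → dropWhileᵇ (s ≤ᵇ_) (replicate q s ++ L) ≡ L
dropWhile-block s zero    []      []        = refl
dropWhile-block s zero    (x ∷ L) (x<s ∷ _) rewrite ≤ᵇ-false x<s = refl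
dropWhile-block s (suc q) L       h         rewrite ≤ᵇ-true {s} ≤-refl = dropWhile-block s q L h

psi-green : ∀ f σ i L → isGreen σ i ≡ true → psiRev (suc f) σ (i ∷ L) ≡ slotValue σ i ∷ psiRev f σ L
psi-green f σ i L e rewrite e = refl

psi-red : ∀ f σ i L → isGreen σ i ≡ false → psiRev (suc f) σ (i ∷ L) ≡
  replicate (length (takeWhileᵇ (i ≤ᵇ_) L)) (slotValue σ i ∸ i) ++
  map suc (psiRev f σ (dropWhileᵇ (i ≤ᵇ_) L)) ++ [ slotValue σ i ]
psi-red f σ i L e rewrite e = refl

module _ (σ : List ℕ) where
  private g = isGreen σ

  -- Ψ of the slots L below s has the multiplicities c, shifted by the number of green slots still to come.
  Tallied : ℕ → ℕ → List ℕ → List ℕ → Set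
  Tallied s m L c = ∀ f → length L < f → ∀ t →
    multiplicity t (psiRev f σ L) ≡ get0 (replicate (count g (seq s m)) 0 ++ c) t

  -- With G green slots still to come, index G of the padded list is the head of the new state. A
  -- green slot has the value G and fills this head. For a red one `slotValue σ s ∸ s` is again G,
  -- and the value `s + G` is the index of the last entry because `length c ≡ s`.
  tallied-step : ∀ s m L c p → s + suc m ≡ suc (length σ) → All (_< s) L → length c ≡ s →
    Tallied s (suc m) L c → Tallied (suc s) m (replicate p s ++ L) (advance (g s) p c)
  tallied-step s m L c p e below len T = by-colour (g s) refl
    where
    G = count g (seq (suc s) m)
    by-colour : ∀ b → g s ≡ b → Tallied (suc s) m (replicate p s ++ L) (advance b p c)
    by-colour true green = go p
      where
      value : slotValue σ s ≡ G
      value = trans (slotValue-eq σ s m e) (cong (λ b → if b then G else s + G) green)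
      go : ∀ p → Tallied (suc s) m (replicate p s ++ L) (p ∷ c)
      -- The slot `s` no longer counts as still to come: the padding loses a zero, which reappears
      -- as the empty content.
      go zero f L<f t = trans (T f L<f t)
        (cong (λ l → get0 l t) (trans (cong (λ n → replicate n 0 ++ c) gs) (replicate-shift G c)))
        where
        gs : count g (seq s (suc m)) ≡ suc G
        gs = trans (count-∷ g s (seq (suc s) m)) (cong (λ b → (if b then 1 else 0) + G) green)
      go (suc p) (suc f) (s≤s L<f) t = begin
        multiplicity t (psiRev (suc f) σ (s ∷ replicate p s ++ L))
          ≡⟨ cong (multiplicity t) (psi-green f σ s (replicate p s ++ L) green) ⟩
        multiplicity t (slotValue σ s ∷ psiRev f σ (replicate p s ++ L))
          ≡⟨ count-∷ (t ≡ᵇ_) (slotValue σ s) _ ⟩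
        (if t ≡ᵇ slotValue σ s then 1 else 0) + multiplicity t (psiRev f σ (replicate p s ++ L))
          ≡⟨ cong₂ (λ v n → (if t ≡ᵇ v then 1 else 0) + n) value (go p f L<f t) ⟩
        (if t ≡ᵇ G then 1 else 0) + get0 (replicate G 0 ++ p ∷ c) t
          ≡⟨ sym (get0-replicate-suc G p c t) ⟩
        get0 (replicate G 0 ++ suc p ∷ c) t ∎
        where open ≡-Reasoning
    by-colour false red = go p
      where
      value : slotValue σ s ≡ s + G
      value = trans (slotValue-eq σ s m e) (cong (λ b → if b then G else s + G) red)
      gs : count g (seq s (suc m)) ≡ G
      gs = trans (count-∷ g s (seq (suc s) m)) (cong (λ b → (if b then 1 else 0) + G) red)
      T' : ∀ f → length L < f → ∀ t → multiplicity t (psiRev f σ L) ≡ get0 (replicate G 0 ++ c) t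
      T' f L<f t = trans (T f L<f t) (cong (λ n → get0 (replicate n 0 ++ c) t) gs)
      go : ∀ p → Tallied (suc s) m (replicate p s ++ L) (advance false p c)
      go zero f L<f t = trans (T' f L<f t)
        (trans (sym (get0-∷ʳ (replicate G 0 ++ c) t)) (cong (λ l → get0 l t) (++-assoc (replicate G 0) c [ 0 ])))
      go (suc q) (suc f) (s≤s L<f) t = begin
        multiplicity t (psiRev (suc f) σ (s ∷ replicate q s ++ L))
          ≡⟨ cong (multiplicity t) (psi-red f σ s (replicate q s ++ L) red) ⟩
        multiplicity t (replicate (length (takeWhileᵇ (s ≤ᵇ_) (replicate q s ++ L))) (slotValue σ s ∸ s) ++
          map suc (psiRev f σ (dropWhileᵇ (s ≤ᵇ_) (replicate q s ++ L))) ++ [ slotValue σ s ])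
          -- All of `L` lies below `s`, so the scan for a smaller entry stops after exactly the q
          -- other copies of `s`; thus k - 1 is q.
          ≡⟨ cong (multiplicity t) (cong₂ (λ a b → a ++ b ++ [ slotValue σ s ])
               (cong₂ replicate (takeWhile-block s q L below) (trans (cong (_∸ s) value) (m+n∸m≡n s G)))
               (cong (map suc ∘ psiRev f σ) (dropWhile-block s q L below))) ⟩
        multiplicity t (replicate q G ++ map suc P ++ [ slotValue σ s ])
          ≡⟨ trans (count-++ (t ≡ᵇ_) (replicate q G) _)
               (cong (multiplicity t (replicate q G) +_) (count-++ (t ≡ᵇ_) (map suc P) _)) ⟩
        multiplicity t (replicate q G) + (multiplicity t (map suc P) + multiplicity t [ slotValue σ s ])
          ≡⟨ cong (multiplicity t (replicate q G) +_) (cong₂ _+_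
               (trans (multiplicity-map-suc P (replicate G 0 ++ c) (T' f L<f′) t)
                 (cong (λ l → get0 l t) (replicate-shift G c)))
               (trans (count-∷ (t ≡ᵇ_) (slotValue σ s) [])
                 (trans (+-identityʳ _) (cong (λ v → if t ≡ᵇ v then 1 else 0) (trans value (cong (_+ G) (sym len))))))) ⟩
        multiplicity t (replicate q G) + (get0 (replicate G 0 ++ 0 ∷ c) t + δ)
          ≡⟨ sym (+-assoc (multiplicity t (replicate q G)) _ δ) ⟩
        multiplicity t (replicate q G) + get0 (replicate G 0 ++ 0 ∷ c) t + δ
          ≡⟨ +-comm _ δ ⟩
        δ + (multiplicity t (replicate q G) + get0 (replicate G 0 ++ 0 ∷ c) t)
          ≡⟨ cong (δ +_) (trans (sym (get0-replicate-+ G q 0 c t))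
               (cong (λ n → get0 (replicate G 0 ++ n ∷ c) t) (+-identityʳ q))) ⟩
        δ + get0 (replicate G 0 ++ q ∷ c) t
          ≡⟨ sym (get0-bumpLast G q c t) ⟩
        get0 (replicate G 0 ++ bumpLast (q ∷ c)) t ∎
        where
        open ≡-Reasoning
        P = psiRev f σ L
        δ = if t ≡ᵇ length c + G then 1 else 0
        L<f′ : length L < f
        L<f′ = ≤-<-trans (subst (length L ≤_) (sym (length-++ (replicate q s))) (m≤n+m _ _)) L<f

  collect : ℕ → List ℕ → List ℕ → List ℕ
  collect s []      L = L
  collect s (p ∷ a) L = collect (suc s) a (replicate p s ++ L)

  psi-run : ∀ s a L c → s + length a ≡ suc (length σ) → All (_< s) L → length c ≡ s →
    Tallied s (length a) L c → ∀ f → length (collect s a L) < f → ∀ t →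
    multiplicity t (psiRev f σ (collect s a L)) ≡ get0 (run c (map g (seq s (length a))) a) t
  psi-run s []      L c e below len T f L<f t = T f L<f t
  psi-run s (p ∷ a) L c e below len T = psi-run (suc s) a (replicate p s ++ L) (advance (g s) p c)
    (trans (sym (+-suc s (length a))) e)
    (All.++⁺ (All.replicate⁺ p ≤-refl) (All.map m<n⇒m<1+n below))
    (trans (advance-length (g s) p c) (cong suc len))
    (tallied-step s (length a) L c p e below len T)

-- Weakly increasing sequences as lists of contents.

expand : ℕ → List ℕ → List ℕ
expand s []      = []
expand s (p ∷ a) = replicate p s ++ expand (suc s) a

expand-ʳ++ : ∀ σ s a L → expand s a ʳ++ L ≡ collect σ s a L
expand-ʳ++ σ s []      L = refl
expand-ʳ++ σ s (p ∷ a) L = trans (++-ʳ++ (replicate p s))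
  (trans (cong (expand (suc s) a ʳ++_) (replicate-ʳ++ p s L)) (expand-ʳ++ σ (suc s) a _))

run-length : ∀ c ks a → length ks ≡ length a → length (run c ks a) ≡ length c + length a
run-length c []       []      e = sym (+-identityʳ _)
run-length c (k ∷ ks) (p ∷ a) e = trans (run-length (advance k p c) ks a (suc-injective e))
  (trans (cong (_+ length a) (advance-length k p c)) (sym (+-suc (length c) (length a))))

All-expand : ∀ s a → All (λ x → s ≤ x × x < s + length a) (expand s a)
All-expand s []      = []
All-expand s (p ∷ a) = All.++⁺ (All.replicate⁺ p (≤-refl , m<m+n s z<s))
  (All.map (λ {x} (l , u) → <⇒≤ l , subst (x <_) (sym (+-suc s (length a))) u) (All-expand (suc s) a))

multiplicity-replicate : ∀ p s → multiplicity s (replicate p s) ≡ p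
multiplicity-replicate zero    s = refl
multiplicity-replicate (suc p) s rewrite ≡ᵇ-true {s} refl = cong suc (multiplicity-replicate p s)

multiplicity-absent : ∀ t l → All (t ≢_) l → multiplicity t l ≡ 0
multiplicity-absent t []      []       = refl
multiplicity-absent t (x ∷ l) (d ∷ ds) rewrite ≡ᵇ-false d = multiplicity-absent t l ds

multiplicity-expand : ∀ s a t → multiplicity (s + t) (expand s a) ≡ get0 a t
multiplicity-expand s []      t       = refl
multiplicity-expand s (p ∷ a) zero    rewrite +-identityʳ s = trans (count-++ (s ≡ᵇ_) (replicate p s) _)
  (trans (cong₂ _+_ (multiplicity-replicate p s)
    (multiplicity-absent s _ (All.map (λ (l , _) → <⇒≢ l) (All-expand (suc s) a)))) (+-identityʳ p))
multiplicity-expand s (p ∷ a) (suc t) = trans (count-++ ((s + suc t) ≡ᵇ_) (replicate p s) _)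
  (cong₂ _+_ (multiplicity-absent _ _ (All.replicate⁺ p (>⇒≢ (m<m+n s z<s))))
    (trans (cong (λ n → multiplicity n (expand (suc s) a)) (+-suc s t)) (multiplicity-expand (suc s) a t)))

Linked-≤ : ∀ {x l} → Linked _≤_ (x ∷ l) → All (x ≤_) l
Linked-≤ [-]       = []
Linked-≤ (h ∷ lk) = h ∷ All.map (≤-trans h) (Linked-≤ lk)

sorted-split : ∀ s l → Linked _≤_ l → All (s ≤_) l →
  ∃₂ λ p l' → l ≡ replicate p s ++ l' × Linked _≤_ l' × All (s <_) l'
sorted-split s []      lk lo         = 0 , [] , refl , [] , []
sorted-split s (x ∷ l) lk (s≤x ∷ lo) with s ≟ x
... | no s≢x = 0 , x ∷ l , refl , lk , s<x ∷ All.map (≤-trans s<x) (Linked-≤ lk)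
  where s<x = ≤∧≢⇒< s≤x s≢x
... | yes refl with sorted-split s l (Linked.tail lk) lo
...   | p , l' , e , lk' , lo' = suc p , l' , cong (s ∷_) e , lk' , lo'

sorted-expand : ∀ m s l → Linked _≤_ l → All (s ≤_) l → All (_< s + m) l →
  ∃ λ a → length a ≡ m × l ≡ expand s a
sorted-expand zero    s []      lk lo hi = [] , refl , refl
sorted-expand zero    s (x ∷ l) lk (s≤x ∷ _) (x<s ∷ _) = ⊥-elim (<⇒≱ (subst (x <_) (+-identityʳ s) x<s) s≤x)
sorted-expand (suc m) s l lk lo hi with sorted-split s l lk lo
... | p , l' , refl , lk' , lo'
  with sorted-expand m (suc s) l' lk' lo'
         (All.++⁻ʳ (replicate p s) (subst (λ n → All (_< n) (replicate p s ++ l')) (+-suc s m) hi))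
...   | a , len , e = p ∷ a , cong suc len , cong (replicate p s ++_) e

incAt-get0 : ∀ j a t → j < length a → get0 (incAt j a) t ≡ (if t ≡ᵇ j then 1 else 0) + get0 a t
incAt-get0 zero    (p ∷ a) zero    _ = refl
incAt-get0 zero    (p ∷ a) (suc t) _ = refl
incAt-get0 (suc j) (p ∷ a) zero    _ = refl
incAt-get0 (suc j) (p ∷ a) (suc t) (s≤s j<) = incAt-get0 j a t j<

tally-get0 : ∀ js a t → All (_< length a) js → get0 (foldl (flip incAt) a js) t ≡ multiplicity t js + get0 a t
tally-get0 []       a t []        = refl
tally-get0 (j ∷ js) a t (j< ∷ js<) = trans
  (tally-get0 js (incAt j a) t (All.map (λ {x} → subst (x <_) (sym (incAt-length j a))) js<))
  (trans (cong (multiplicity t js +_) (incAt-get0 j a t j<)) (trans (sym (+-assoc (multiplicity t js) _ _))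
    (cong (_+ get0 a t) (trans (+-comm (multiplicity t js) _) (sym (count-∷ (t ≡ᵇ_) j js))))))

tally-length : ∀ js a → length (foldl (flip incAt) a js) ≡ length a
tally-length []       a = refl
tally-length (j ∷ js) a = trans (tally-length js (incAt j a)) (incAt-length j a)

get0-ext : ∀ a b → length a ≡ length b → (∀ t → get0 a t ≡ get0 b t) → a ≡ b
get0-ext []      []      _ h = refl
get0-ext (x ∷ a) (y ∷ b) e h = cong₂ _∷_ (h 0) (get0-ext a b (suc-injective e) (h ∘ suc))

get0-zeros : ∀ n t → get0 (replicate n 0) t ≡ 0
get0-zeros zero    t       = refl
get0-zeros (suc n) zero    = refl
get0-zeros (suc n) (suc t) = get0-zeros n t

get0-out : ∀ a t → length a ≤ t → get0 a t ≡ 0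
get0-out []      t       _       = refl
get0-out (x ∷ a) (suc t) (s≤s h) = get0-out a t h

multiplicity-bound : ∀ n js → (∀ t → n ≤ t → multiplicity t js ≡ 0) → All (_< n) js
multiplicity-bound n []       h = []
multiplicity-bound n (j ∷ js) h with j <? n
... | yes j<n = j<n ∷ multiplicity-bound n js λ t n≤t →
  m+n≡0⇒n≡0 (if t ≡ᵇ j then 1 else 0) (trans (sym (count-∷ (t ≡ᵇ_) j js)) (h t n≤t))
... | no  j≮n = ⊥-elim (1+n≢0 (trans (sym (trans (count-∷ (j ≡ᵇ_) j js)
  (cong (λ b → (if b then 1 else 0) + multiplicity j js) (≡ᵇ-true {j} refl)))) (h j (≮⇒≥ j≮n))))

-- On contents the insertions are independent increments, so the order of `js` does not matter. That
-- all of `js` are genuine slots follows from the multiplicities too, since `a` has no entry beyond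
-- the last slot; no separate bound for the output of Ψ is required.
ZDer-multiplicity : ∀ {k σ} → IsDerangement k σ → ∀ a js → length a ≡ suc (length σ) →
  (∀ t → multiplicity t js ≡ get0 a t) → ZDer (insertSeq σ js) ≡ weave a σ
ZDer-multiplicity {k} {σ} d a js len h = trans
  (ZDer-insertSeq σ (replicate (suc n) 0) σ js len₀ (All.map proj₁ (perm-bounds (proj₁ d)))
    (All.map s≤s⁻¹ bound) (trans (ZDer-derangement d) (sym (weave-zeros σ))))
  (cong (λ c → weave c σ) (get0-ext _ a
    (trans (tally-length js _) (trans len₀ (sym len)))
    λ t → trans (tally-get0 js _ t (subst (λ m → All (_< m) js) (sym len₀) bound))
      (trans (cong (multiplicity t js +_) (get0-zeros (suc n) t)) (trans (+-identityʳ _) (h t)))))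
  where
  n = length σ
  len₀ : length (replicate (suc n) 0) ≡ suc n
  len₀ = length-replicate (suc n)
  bound : All (_< suc n) js
  bound = multiplicity-bound (suc n) js λ t n<t → trans (h t) (get0-out a t (subst (_≤ t) (sym len) n<t))

multiplicity-ΨSeq : ∀ σ a → length a ≡ suc (length σ) →
  ∀ t → multiplicity t (ΨSeq σ (expand 0 a)) ≡ get0 (run [] (map (isGreen σ) (seq 0 (length a))) a) t
multiplicity-ΨSeq σ a len t rewrite expand-ʳ++ σ 0 a [] =
  psi-run σ 0 a [] [] len [] refl (λ f _ t → trans (none f t) (sym (zeros-only (count (isGreen σ) (seq 0 (length a))) t))) _
    (s≤s (≤-reflexive (trans (cong length (sym (expand-ʳ++ σ 0 a []))) (length-reverse (expand 0 a))))) t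
  where
  none : ∀ f t → multiplicity t (psiRev f σ []) ≡ 0
  none zero    t = refl
  none (suc f) t = refl
  zeros-only : ∀ n t → get0 (replicate n 0 ++ []) t ≡ 0
  zeros-only n t = trans (cong (λ l → get0 l t) (++-identityʳ (replicate n 0))) (get0-zeros n t)

-- Provides the strictness that `Φ-weave` uses at slots that are not descents.
perm-adjacent : ∀ {k σ} → IsPerm k σ → Linked _≢_ σ
perm-adjacent {k} perm = AllPairs⇒Linked (Unique-resp-↭ (setoid ℕ) (↭⇒↭ₛ (↭-sym perm))
  (Unique.map⁺ suc-injective (Unique.upTo⁺ k)))

theorem3 : (k : ℕ) (σ : List ℕ) → IsDerangement k σ →
    (is : List ℕ) → Linked _≤_ is → All (_≤ k) is → 1 ≤ k + length is →
    (w : List ℕ) → Φ w ≡ ZDer (insertSeq σ is) →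
    F w ≡ ZDer (Ψ σ is)
theorem3 k σ d is sorted bounded _ w Φw≡
  with sorted-expand (suc (length σ)) 0 is sorted (All.map (λ _ → z≤n) bounded)
         (All.map (λ {x} i≤k → s≤s (subst (x ≤_) (sym (perm-length (proj₁ d))) i≤k)) bounded)
     | unweave w
... | p ∷ a , len , refl | q , b , len′ , w≡ = begin
  F w
    ≡⟨ cong F w≡σ ⟩
  F (weave (q ∷ b) σ)
    ≡⟨ F-weave q b σ lenb pos ⟩
  weave (run [] (true ∷ descents σ) (q ∷ b)) σ
    -- Slot 0 has the first colour before and after the exchanges: the first letter has rank 1 and
    -- cannot be subexcedent, so no block begins there.
    ≡⟨ cong (λ c → weave (run [] (c ∷ descents σ) (q ∷ b)) σ) (sym (if-true (subR 0 σ))) ⟩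
  weave (run [] ((if subR 0 σ then true else true) ∷ descents σ) (q ∷ b)) σ
    ≡⟨ cong (λ c → weave c σ) (run-hat true 0 [] q b σ lenb pos (proj₂ d)) ⟩
  weave (run [] ((if subR 0 σ then false else true) ∷ greens 0 σ) (hat 0 (q ∷ b) σ)) σ
    ≡⟨ cong₂ (λ s c → weave (run [] ((if s then false else true) ∷ greens 0 σ) c) σ) (first-excedent σ pos) hat≡ ⟩
  weave (run [] (true ∷ greens 0 σ) (p ∷ a)) σ
    ≡⟨ cong (λ ks → weave (run [] ks (p ∷ a)) σ) (trans (isGreen-colours d) (cong (λ n → map (isGreen σ) (seq 0 n)) (sym len))) ⟩
  weave (run [] colours (p ∷ a)) σ
    ≡⟨ sym (ZDer-multiplicity d _ (ΨSeq σ (expand 0 (p ∷ a)))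
         (trans (run-length [] colours (p ∷ a) (trans (length-map (isGreen σ) (seq 0 (suc (length a)))) (length-seq 0 (suc (length a))))) len)
         (multiplicity-ΨSeq σ (p ∷ a) len)) ⟩
  ZDer (Ψ σ (expand 0 (p ∷ a))) ∎
  where
  open ≡-Reasoning
  colours = map (isGreen σ) (seq 0 (length (p ∷ a)))
  pos : All (0 <_) σ
  pos = All.map proj₁ (perm-bounds (proj₁ d))
  lena : length a ≡ length σ
  lena = suc-injective len
  Φw : Φ w ≡ weave (p ∷ a) σ
  Φw = trans Φw≡ (ZDer-multiplicity d (p ∷ a) (expand 0 (p ∷ a)) len (multiplicity-expand 0 (p ∷ a)))
  strip-w : strip w ≡ σ
  strip-w = trans (sym (strip-Φ w)) (trans (cong strip Φw) (strip-weave p a σ lena pos))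
  w≡σ : w ≡ weave (q ∷ b) σ
  w≡σ = trans w≡ (cong (weave (q ∷ b)) strip-w)
  lenb : length b ≡ length σ
  lenb = trans len′ (cong length strip-w)
  -- Both lists are contents of `Φ w`, one by `Φ-weave` and one by assumption, and the letters σ are
  -- the same.
  hat≡ : hat 0 (q ∷ b) σ ≡ p ∷ a
  hat≡ = from-cons (hat-cons 0 q b σ)
    where
    from-cons : (∃₂ λ h c → hat 0 (q ∷ b) σ ≡ h ∷ c) → hat 0 (q ∷ b) σ ≡ p ∷ a
    from-cons (h , c , e) = trans e (weave-injective h c p a σ
      (trans (suc-injective (trans (cong length (sym e)) (hat-length 0 (q ∷ b) σ))) lenb) lena pos
      (trans (cong (λ l → weave l σ) (sym e))
        (trans (sym (Φ-weave q b σ lenb pos (perm-adjacent (proj₁ d)))) (trans (cong Φ (sym w≡σ)) Φw))))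
  first-excedent : ∀ v → All (0 <_) v → subR 0 v ≡ false
  first-excedent []          _ = refl
  first-excedent (zero ∷ v)  _ = refl
  first-excedent (suc y ∷ v) _ = refl
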